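{- Let $\mathbf i=(i_1,i_2,\dots)\in\mathbb{N}^{\mathbb{N}}$ and let $\mu_{\mathbf i}$ be the corresponding infinite mutation sequence on $\mathbf{LF}$. Let $S_\infty\subseteq\mathbb{N}$ be the set of values appearing infinitely many times in $\mathbf i$. Exactly one of the following occurs: (i) $\mathcal C_{\mathbf{LF}}(\mu_{\mathbf i})=\mathbf{LF}$ (so $\mathcal D_{\mathbf{LF}}(\mu_{\mathbf i})=\varnothing$); this occurs precisely when $S_\infty=\varnothing$ and the reduction $\overline\mu_{\mathbf i}$ is finite. (ii) $\mathcal C_{\mathbf{LF}}(\mu_{\mathbf i})$ and $\mathcal D_{\mathbf{LF}}(\mu_{\mathbf i})$ are both dense in $\mathbf{LF}$; this occurs precisely when $S_\infty=\varnothing$ and $\overline\mu_{\mathbf i}$ is infinite. (iii) $\mathcal C_{\mathbf{LF}}(\mu_{\mathbf i})$ is not dense in $\mathbf{LF}$; this occurs precisely when $S_\infty\neq\varnothing$. In this case, $\mathcal D_{\mathbf{LF}}(\mu_{\mathbf i})$ is dense in $\mathbf{LF}$ if and only if $S_\infty$ is infinite or $\overline\mu_{\mathbf i_{\mathbb{N}\setminus S_\infty}}$ is infinite (or both).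
   Context: $\mathbb{N}$ is the positive integers. A quiver on $\mathbb{N}$ is a function $Q:\mathbb{N}\times\mathbb{N}\to\mathbb{Z}$ with $Q(x,y)=-Q(y,x)$; it is locally finite if $\sum_y|Q(x,y)|<\infty$ for each $x$. For $V\subseteq\mathbb{N}$, the overfill $\lambda_V(Q)(x,y)=Q(x,y)$ if $x\in V$ or $y\in V$, else $0$. $\mathbf{LF}$ is the set of locally finite quivers on $\mathbb{N}$ with the topology generated by the basic sets $\{Q'\in\mathbf{LF}:\lambda_V(Q')=\lambda_V(Q)\}$, $V\subseteq\mathbb{N}$ finite. Mutation at $x$: $\mu_x(Q)(v,w)=-Q(v,w)$ if $x\in\{v,w\}$, otherwise $\mu_x(Q)(v,w)=Q(v,w)+Q(v,x)[Q(x,w)]_++[-Q(v,x)]_+Q(x,w)$, $[a]_+=\max(a,0)$. $\mu_{\mathbf i}$ converges on $Q$ if $(\mu_{i_m}\circ\cdots\circ\mu_{i_1}(Q))_{m\ge1}$ converges in $\mathbf{LF}$, and diverges otherwise; $\mathcal C_{\mathbf{LF}}(\mu_{\mathbf i})$ is the set of $Q\in\mathbf{LF}$ on which it converges, $\mathcal D_{\mathbf{LF}}(\mu_{\mathbf i})=\mathbf{LF}\setminus\mathcal C_{\mathbf{LF}}(\mu_{\mathbf i})$. For $S\subseteq\mathbb{N}$, $\mathbf i_S$ is the (finite or infinite) subsequence of $\mathbf i$ obtained by deleting all entries not in $S$. Reduction: let $\mathbf j=(j_1,j_2,\dots)$ be a finite or infinite sequence in which every value appears finitely often, viewed as a function on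 its set of positions $K_0$. For a sequence viewed as a function $s$ on a set of positions $K\subseteq\mathbb{N}$ (ordered as in $\mathbb{N}$), a block is a maximal set of positions consecutive in $K$ on which $s$ is constant; the one-step reduction $R(s)$ is the restriction of $s$ to the set of least positions of the blocks of odd cardinality (even-size blocks are deleted, odd-size blocks are replaced by their first entry). Iterating gives position sets $K_0\supseteq K_1\supseteq K_2\supseteq\cdots$; with $\bigcap_m K_m=\{k_1<k_2<\cdots\}$ (possibly finite or empty), the reduction $\overline\mu_{\mathbf j}$ is the mutation sequence given by $(j_{k_1},j_{k_2},\dots)$; it is called finite or infinite according to whether this sequence is. -}

module Defs where

open import Level using (0ℓ)
open import Data.Nat as ℕ using (ℕ; zero; suc; _≤_; _<_)
open import Data.Integer as ℤ using (ℤ; _+_; _*_; -_; _⊔_; ∣_∣; 0ℤ)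
open import Data.Bool using (Bool; if_then_else_; _∨_)
open import Data.List using (List; length)
open import Data.List.Membership.DecPropositional ℕ._≟_ using (_∈_; _∈?_)
open import Data.List.Relation.Unary.Unique.Propositional using (Unique)
open import Data.Product using (Σ; ∃; ∃-syntax; _×_; _,_)
open import Data.Sum using (_⊎_)
open import Data.Unit using (⊤)
open import Relation.Nullary using (¬_)
open import Relation.Nullary.Decidable using (⌊_⌋)
open import Relation.Binary.PropositionalEquality using (_≡_)

-- Vertices and positions: ℕ = {0,1,2,...} stands for the positive integers
-- via the order-preserving shift n ↦ n+1.

Quiver : Set
Quiver = ℕ → ℕ → ℤ

IsSkew : Quiver → Set
IsSkew Q = ∀ x y → Q x y ≡ - Q y x

psum : (ℕ → ℕ) → ℕ → ℕ
psum f zero = 0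
psum f (suc n) = psum f n ℕ.+ f n

LocallyFinite : Quiver → Set
LocallyFinite Q = ∀ x → ∃[ B ] (∀ n → psum (λ y → ∣ Q x y ∣) n ≤ B)

record LFQuiver : Set where
  constructor mkLF
  field
    quiver : Quiver
    skew   : IsSkew quiver
    locFin : LocallyFinite quiver
open LFQuiver public

overfill : List ℕ → Quiver → Quiver
overfill V Q x y = if ⌊ x ∈? V ⌋ ∨ ⌊ y ∈? V ⌋ then Q x y else 0ℤ

_≐_ : Quiver → Quiver → Set
Q ≐ Q' = ∀ x y → Q x y ≡ Q' x y

[_]₊ : ℤ → ℤ
[ a ]₊ = a ⊔ 0ℤ

μ : ℕ → Quiver → Quiver
μ x Q v w =
  if ⌊ x ℕ.≟ v ⌋ ∨ ⌊ x ℕ.≟ w ⌋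
  then - Q v w
  else Q v w + Q v x * [ Q x w ]₊ + [ - Q v x ]₊ * Q x w

-- iterMut i Q m = μ_{i_m} ∘ ... ∘ μ_{i_1} (Q), where i 0 plays the role of i_1
iterMut : (ℕ → ℕ) → Quiver → ℕ → Quiver
iterMut i Q zero = Q
iterMut i Q (suc m) = μ (i m) (iterMut i Q m)

ConvergesTo : (ℕ → ℕ) → Quiver → LFQuiver → Set
ConvergesTo i Q L =
  ∀ (V : List ℕ) → ∃[ M ] (∀ m → M ≤ m →
     overfill V (iterMut i Q (suc m)) ≐ overfill V (quiver L))

𝒞 : (ℕ → ℕ) → LFQuiver → Set
𝒞 i Q = ∃[ L ] ConvergesTo i (quiver Q) L

𝒟 : (ℕ → ℕ) → LFQuiver → Set
𝒟 i Q = ¬ 𝒞 i Q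

-- A ⊆ LF is dense: it meets every (nonempty) basic open set
Dense : (LFQuiver → Set) → Set
Dense A = ∀ (Q : LFQuiver) (V : List ℕ) →
  ∃[ Q' ] (A Q' × (overfill V (quiver Q') ≐ overfill V (quiver Q)))

InfOften : (ℕ → ℕ) → ℕ → Set
InfOften i v = ∀ n → ∃[ m ] (n ≤ m × i m ≡ v)

SinfEmpty : (ℕ → ℕ) → Set
SinfEmpty i = ∀ v → ¬ InfOften i v

SinfFinite : (ℕ → ℕ) → Set
SinfFinite i = ∃[ N ] (∀ v → InfOften i v → v < N)

SinfInfinite : (ℕ → ℕ) → Set
SinfInfinite i = ¬ SinfFinite i

-- Reduction.  A sequence is given as the values  s : ℕ → ℕ  restricted
-- to a set of positions  K : ℕ → Set  (ordered as in ℕ).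

Odd : ℕ → Set
Odd n = ∃[ k ] (n ≡ suc (2 ℕ.* k))

HasOddCard : (ℕ → Set) → Set
HasOddCard P = ∃[ l ] (Unique l × Odd (length l) × (∀ q → (P q → q ∈ l) × (q ∈ l → P q)))

module _ (s : ℕ → ℕ) where

  IsPredIn : (ℕ → Set) → ℕ → ℕ → Set
  IsPredIn K r p = K r × r < p × (∀ t → r < t → t < p → ¬ K t)

  BlockStart : (ℕ → Set) → ℕ → Set
  BlockStart K p = K p × (∀ r → IsPredIn K r p → ¬ s r ≡ s p)

  InBlock : (ℕ → Set) → ℕ → ℕ → Set
  InBlock K p q = K q × p ≤ q × (∀ t → p ≤ t → t ≤ q → K t → s t ≡ s p)

  -- position sets K_0 ⊇ K_1 ⊇ ... of the iterated one-step reduction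
  Kseq : (ℕ → Set) → ℕ → ℕ → Set
  Kseq K₀ zero = K₀
  Kseq K₀ (suc m) p = BlockStart (Kseq K₀ m) p × HasOddCard (InBlock (Kseq K₀ m) p)

  ReducedPos : (ℕ → Set) → ℕ → Set
  ReducedPos K₀ p = ∀ m → Kseq K₀ m p

  ReductionFinite : (ℕ → Set) → Set
  ReductionFinite K₀ = ∃[ N ] (∀ p → ReducedPos K₀ p → p < N)

  ReductionInfinite : (ℕ → Set) → Set
  ReductionInfinite K₀ = ¬ ReductionFinite K₀

AllPos : ℕ → Set
AllPos _ = ⊤

NotSinfPos : (ℕ → ℕ) → ℕ → Set
NotSinfPos i p = ¬ InfOften i (i p)

ExactlyOne : Set → Set → Set → Set
ExactlyOne A B C = (A ⊎ B ⊎ C) × ¬ (A × B) × ¬ (A × C) × ¬ (B × C)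

{-# OPTIONS --safe #-}
-- If v ∈ S∞ and μ_i converges on Q, then at a late mutation at v the row of v equals its own
-- negative, so v is isolated, and undoing the mutations shows that v was isolated in Q.
--
-- If the reduction is finite, the quivers return to one fixed quiver Q* at arbitrarily late
-- times, because up to a block boundary the sequence and its reductions act alike.  Once a
-- vertex and its neighbours in Q* are no longer mutated, its row stays what it is in Q*.
--
-- If the reduction is infinite, then beyond any bound there is a finite interval of vertices
-- whose letters do not cancel in the free product of copies of ℤ/2.  These intervals form a
-- chain in which each carries a transitive tournament of double arrows, with the port of the
-- next one included.  When its turn comes, a fixed vertex x is joined to the interval through
-- its port only, the first uncancelled letter.  Mutating there creates a fork (Warkentin), and
-- reduced mutation sequences preserve forks, so x ends up joined to the next port: row x
-- never stabilizes.
module Submission where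

open import Defs
open import Level using (0ℓ)
open import Axiom.ExcludedMiddle using (ExcludedMiddle)
open import Data.Nat as ℕ using (ℕ; zero; suc; _≤_; _<_; z≤n; s≤s; _<?_; _≟_)
import Data.Nat.Properties as ℕₚ
open import Data.Integer as ℤ using (ℤ; +_; -[1+_]; _+_; _*_; -_; ∣_∣; 0ℤ; 1ℤ)
import Data.Integer.Properties as ℤₚ
open import Data.Integer.Tactic.RingSolver using (solve-∀)
open import Data.List using (List; []; _∷_; length; foldr; upTo)
open import Data.List.Membership.DecPropositional ℕ._≟_ using (_∈_; _∈?_)
open import Data.List.Membership.Propositional.Properties using (∈-upTo⁺)
open import Data.List.Membership.Propositional.Properties.WithK using (unique∧set⇒bag)
open import Data.List.Relation.Binary.BagAndSetEquality using (∼bag⇒↭)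
open import Data.List.Relation.Binary.Permutation.Propositional.Properties using (↭-length)
open import Data.List.Relation.Unary.All as All using (All; []; _∷_)
open import Data.List.Relation.Unary.AllPairs using ([]; _∷_)
open import Data.List.Relation.Unary.Any using (here; there)
open import Data.List.Relation.Unary.Linked using (Linked; []; [-]; _∷_)
open import Data.List.Relation.Unary.Unique.Propositional using (Unique)
open import Data.Product using (∃-syntax; _×_; _,_; proj₁; proj₂)
open import Data.Sum using (_⊎_; inj₁; inj₂; swap)
open import Data.Empty using (⊥; ⊥-elim)
open import Function using (_∘_; case_of_; mk⇔)
open import Function.Bundles using (_⇔_)
open import Relation.Nullary using (¬_; Dec; yes; no)
open import Relation.Nullary.Decidable using (decidable-stable)
open import Relation.Binary.Definitions using (tri<; tri≈; tri>)
open import Relation.Binary.PropositionalEquality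
  using (_≡_; _≢_; refl; sym; trans; cong; cong₂; subst; subst₂; module ≡-Reasoning)

-- Two obstacles shape the proof. A finite reduction need not be attained at any finite stage of the
-- iteration, and a stage agrees with the next one only at times that split no block. So either all
-- stages are infinite, and return times are taken from later and later stages, or the first finite
-- stage supplies them. For divergence, the reduction involves all letters outside `S∞`, while the
-- added arrows must avoid `S∞` and the finitely many rows fixed by a basic open set. Letters below
-- a bound therefore have to be dropped. Outside `S∞` they occur finitely often, hence only before
-- some time, and since letters act invertibly their effect can be absorbed into the initial state.
-- Arrows are double because two factors that are at least 2 have a product that beats an opposing
-- edge smaller than one of them; with simple arrows the estimate fails. Each port is the source of
-- its tournament, so that one mutation there joins `x` to all the rest.

module _ (em : ExcludedMiddle 0ℓ) where

  -- Classical reasoning about subsets of ℕ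

  dne : {P : Set} → ¬ ¬ P → P
  dne = decidable-stable em

  classical : (P : Set) → P ⊎ ¬ P
  classical P with em {P}
  ... | yes p = inj₁ p
  ... | no ¬p = inj₂ ¬p

  ¬∀⇒∃¬ : {P : ℕ → Set} → ¬ (∀ n → P n) → ∃[ n ] ¬ P n
  ¬∀⇒∃¬ ¬all = dne λ ¬ex → ¬all λ n → dne λ ¬p → ¬ex (n , ¬p)

  Unbounded : (ℕ → Set) → Set
  Unbounded P = ∀ n → ∃[ p ] (n ≤ p × P p)

  Eventually : (ℕ → Set) → Set
  Eventually P = ∃[ n ] (∀ m → n ≤ m → P m)

  ¬bounded⇒unbounded : {P : ℕ → Set} → ¬ (∃[ N ] (∀ p → P p → p < N)) → Unbounded P
  ¬bounded⇒unbounded ¬bdd n = dne λ ¬ex →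
    ¬bdd (n , λ p Pp → ℕₚ.≰⇒> λ n≤p → ¬ex (p , n≤p , Pp))

  ¬unbounded⇒eventually¬ : {P : ℕ → Set} → ¬ Unbounded P → Eventually (λ n → ¬ P n)
  ¬unbounded⇒eventually¬ ¬unb with ¬∀⇒∃¬ ¬unb
  ... | n , h = n , λ m n≤m Pm → h (m , n≤m , Pm)

  eventually-below : {R : ℕ → ℕ → Set} (B : ℕ) →
    (∀ v → v < B → Eventually (R v)) → Eventually (λ m → ∀ v → v < B → R v m)
  eventually-below zero h = 0 , λ _ _ _ ()
  eventually-below {R} (suc B) h with eventually-below {R} B (λ v v<B → h v (ℕₚ.m<n⇒m<1+n v<B)) | h B ℕₚ.≤-refl
  ... | T , f | T′ , g = T ℕ.⊔ T′ , λ m le v v<sB →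
    case ℕₚ.m≤n⇒m<n∨m≡n (ℕₚ.≤-pred v<sB) of λ where
      (inj₁ v<B) → f m (ℕₚ.≤-trans (ℕₚ.m≤m⊔n T T′) le) v v<B
      (inj₂ refl) → g m (ℕₚ.≤-trans (ℕₚ.m≤n⊔m T T′) le)

  leastBelow : {P : ℕ → Set} → ∀ n →
    (∀ k → k < n → ¬ P k) ⊎ (∃[ k ] (k < n × P k × (∀ j → j < k → ¬ P j)))
  leastBelow zero = inj₁ λ _ ()
  leastBelow {P} (suc n) with leastBelow {P} n
  ... | inj₂ (k , k<n , r) = inj₂ (k , ℕₚ.m<n⇒m<1+n k<n , r)
  ... | inj₁ none with em {P n}
  ...   | yes Pn = inj₂ (n , ℕₚ.≤-refl , Pn , none)
  ...   | no ¬Pn = inj₁ λ k k<sn → case ℕₚ.m≤n⇒m<n∨m≡n (ℕₚ.≤-pred k<sn) of λ where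
            (inj₁ k<n) → none k k<n
            (inj₂ refl) → ¬Pn

  least : {P : ℕ → Set} → ∀ {n} → P n → ∃[ k ] (k ≤ n × P k × (∀ j → j < k → ¬ P j))
  least {P} {n} Pn with leastBelow {P} (suc n)
  ... | inj₁ none = ⊥-elim (none n ℕₚ.≤-refl Pn)
  ... | inj₂ (k , s≤s k≤n , r) = k , k≤n , r

  finOften⇒eventually≢ : ∀ {i : ℕ → ℕ} {v} → ¬ InfOften i v → Eventually (λ m → i m ≢ v)
  finOften⇒eventually≢ = ¬unbounded⇒eventually¬

  -- Mutation

  μ-incident : ∀ x Q v w → x ≡ v ⊎ x ≡ w → μ x Q v w ≡ - Q v w
  μ-incident x Q v w h with x ≟ v | x ≟ w
  ... | yes _ | _ = refl
  ... | no _ | yes _ = refl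
  μ-incident x Q v w (inj₁ e) | no x≢v | no _ = ⊥-elim (x≢v e)
  μ-incident x Q v w (inj₂ e) | no _ | no x≢w = ⊥-elim (x≢w e)

  μ-apart : ∀ x Q v w → x ≢ v → x ≢ w →
    μ x Q v w ≡ Q v w + Q v x * [ Q x w ]₊ + [ - Q v x ]₊ * Q x w
  μ-apart x Q v w x≢v x≢w with x ≟ v | x ≟ w
  ... | yes e | _ = ⊥-elim (x≢v e)
  ... | no _ | yes e = ⊥-elim (x≢w e)
  ... | no _ | no _ = refl

  incident? : ∀ (x v w : ℕ) → (x ≡ v ⊎ x ≡ w) ⊎ (x ≢ v × x ≢ w)
  incident? x v w with x ≟ v | x ≟ w
  ... | yes e | _ = inj₁ (inj₁ e)
  ... | no _ | yes e = inj₁ (inj₂ e)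
  ... | no n | no n′ = inj₂ (n , n′)

  no-path : ∀ q a b → a ≡ 0ℤ ⊎ b ≡ 0ℤ → q + a * [ b ]₊ + [ - a ]₊ * b ≡ q
  no-path q a b (inj₁ refl) = trans (ℤₚ.+-identityʳ _) (ℤₚ.+-identityʳ _)
  no-path q a b (inj₂ refl) =
    trans (cong₂ _+_ (cong (λ z → q + z) (ℤₚ.*-zeroʳ a)) (ℤₚ.*-zeroʳ [ - a ]₊))
          (trans (ℤₚ.+-identityʳ _) (ℤₚ.+-identityʳ _))

  μ-no-path : ∀ x Q v w → x ≢ v → x ≢ w → Q v x ≡ 0ℤ ⊎ Q x w ≡ 0ℤ → μ x Q v w ≡ Q v w
  μ-no-path x Q v w x≢v x≢w h = trans (μ-apart x Q v w x≢v x≢w) (no-path _ _ _ h)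

  μ-zero : ∀ x Q v w → Q v w ≡ 0ℤ → Q v x ≡ 0ℤ ⊎ Q x w ≡ 0ℤ → μ x Q v w ≡ 0ℤ
  μ-zero x Q v w q h with incident? x v w
  ... | inj₁ e = trans (μ-incident x Q v w e) (cong -_ q)
  ... | inj₂ (a , b) = trans (μ-no-path x Q v w a b h) q

  μ-cong-on : (T : ℕ → Set) → ∀ {x} {Q Q′ : Quiver} → T x →
    (∀ v w → T v → T w → Q v w ≡ Q′ v w) → ∀ v w → T v → T w → μ x Q v w ≡ μ x Q′ v w
  μ-cong-on T {x} Tx h v w Tv Tw
    rewrite h v w Tv Tw | h v x Tv Tx | h x w Tx Tw = refl

  μ-cong : ∀ x {Q Q′} → Q ≐ Q′ → μ x Q ≐ μ x Q′
  μ-cong x h v w rewrite h v w | h v x | h x w = refl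

  -- Eliminates one of `[ a ]₊` and `[ - a ]₊`; with the other kept as a free variable, involutivity
  -- of mutation becomes a ring identity.
  []₊-split : ∀ a → [ a ]₊ ≡ a + [ - a ]₊
  []₊-split (+ zero) = refl
  []₊-split (+ suc n) = sym (ℤₚ.+-identityʳ _)
  []₊-split -[1+ n ] = sym (ℤₚ.+-inverseˡ (+ suc n))

  μ-involutive : ∀ x Q → μ x (μ x Q) ≐ Q
  μ-involutive x Q v w with incident? x v w
  ... | inj₁ e = trans (μ-incident x (μ x Q) v w e)
                   (trans (cong -_ (μ-incident x Q v w e)) (ℤₚ.neg-involutive _))
  ... | inj₂ (a , b) = begin
    μ x (μ x Q) v w
      ≡⟨ μ-apart x (μ x Q) v w a b ⟩
    μ x Q v w + μ x Q v x * [ μ x Q x w ]₊ + [ - μ x Q v x ]₊ * μ x Q x w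
      ≡⟨ cong₂ (λ s t → μ x Q v w + s * [ t ]₊ + [ - s ]₊ * t)
           (μ-incident x Q v x (inj₂ refl)) (μ-incident x Q x w (inj₁ refl)) ⟩
    μ x Q v w + - Q v x * [ - Q x w ]₊ + [ - - Q v x ]₊ * - Q x w
      ≡⟨ cong₂ (λ s t → s + - Q v x * [ - Q x w ]₊ + t * - Q x w) (μ-apart x Q v w a b)
           (trans (cong [_]₊ (ℤₚ.neg-involutive (Q v x))) ([]₊-split (Q v x))) ⟩
    Q v w + Q v x * [ Q x w ]₊ + [ - Q v x ]₊ * Q x w
      + - Q v x * [ - Q x w ]₊ + (Q v x + [ - Q v x ]₊) * - Q x w
      ≡⟨ cong (λ s → Q v w + Q v x * s + [ - Q v x ]₊ * Q x w
                + - Q v x * [ - Q x w ]₊ + (Q v x + [ - Q v x ]₊) * - Q x w) ([]₊-split (Q x w)) ⟩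
    Q v w + Q v x * (Q x w + [ - Q x w ]₊) + [ - Q v x ]₊ * Q x w
      + - Q v x * [ - Q x w ]₊ + (Q v x + [ - Q v x ]₊) * - Q x w
      ≡⟨ cancel (Q v w) (Q v x) (Q x w) [ - Q v x ]₊ [ - Q x w ]₊ ⟩
    Q v w ∎
    where
    open ≡-Reasoning
    cancel : ∀ q s t s⁻ t⁻ →
      q + s * (t + t⁻) + s⁻ * t + - s * t⁻ + (s + s⁻) * - t ≡ q
    cancel = solve-∀

  μ-skew : ∀ x {Q} → IsSkew Q → IsSkew (μ x Q)
  μ-skew x {Q} sk v w with incident? x v w
  ... | inj₁ e = trans (μ-incident x Q v w e)
                   (cong -_ (trans (sk v w) (sym (μ-incident x Q w v (swap e)))))
  ... | inj₂ (a , b) = begin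
    μ x Q v w
      ≡⟨ μ-apart x Q v w a b ⟩
    Q v w + Q v x * [ Q x w ]₊ + [ - Q v x ]₊ * Q x w
      ≡⟨ flip (Q v w) (Q v x) (Q x w) [ Q x w ]₊ [ - Q v x ]₊ ⟩
    - (- Q v w + - Q x w * [ - Q v x ]₊ + [ Q x w ]₊ * - Q v x)
      ≡⟨ cong (λ z → - (- Q v w + - Q x w * [ - Q v x ]₊ + [ z ]₊ * - Q v x))
           (sym (ℤₚ.neg-involutive (Q x w))) ⟩
    - (- Q v w + - Q x w * [ - Q v x ]₊ + [ - - Q x w ]₊ * - Q v x)
      ≡⟨ cong -_ (sym (cong₂ _+_ (cong₂ _+_ (sk w v) (cong₂ _*_ (sk w x) (cong [_]₊ (sk x v))))
                             (cong₂ _*_ (cong (λ z → [ - z ]₊) (sk w x)) (sk x v)))) ⟩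
    - (Q w v + Q w x * [ Q x v ]₊ + [ - Q w x ]₊ * Q x v)
      ≡⟨ cong -_ (sym (μ-apart x Q w v b a)) ⟩
    - μ x Q w v ∎
    where
    open ≡-Reasoning
    flip : ∀ q s t t⁺ s⁻ → q + s * t⁺ + s⁻ * t ≡ - (- q + - t * s⁻ + t⁺ * - s)
    flip = solve-∀

  skew-zero : ∀ {Q} → IsSkew Q → ∀ {v w} → Q v w ≡ 0ℤ → Q w v ≡ 0ℤ
  skew-zero sk {v} {w} e = trans (sk w v) (cong -_ e)

  skew-diag : ∀ {Q} → IsSkew Q → ∀ v → Q v v ≡ 0ℤ
  skew-diag {Q} sk v with Q v v | sk v v
  ... | + zero | _ = refl
  ... | + suc n | ()
  ... | -[1+ n ] | ()

  -- Isolated vertices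

  Isolated : Quiver → ℕ → Set
  Isolated Q v = ∀ w → Q v w ≡ 0ℤ

  μ-isolated : ∀ x Q {v} → Isolated Q v → Isolated (μ x Q) v
  μ-isolated x Q {v} iso w = μ-zero x Q v w (iso w) (inj₁ (iso x))

  isolated-cong : ∀ {Q Q′ v} → Q ≐ Q′ → Isolated Q v → Isolated Q′ v
  isolated-cong {v = v} h iso w = trans (sym (h v w)) (iso w)

  μ-isolated⁻ : ∀ x Q {v} → Isolated (μ x Q) v → Isolated Q v
  μ-isolated⁻ x Q {v} iso = isolated-cong {v = v} (μ-involutive x Q) (μ-isolated x (μ x Q) {v} iso)

  μ-at-isolated : ∀ {x Q} → IsSkew Q → Isolated Q x → μ x Q ≐ Q
  μ-at-isolated {x} {Q} sk iso v w with incident? x v w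
  ... | inj₁ (inj₁ refl) = trans (μ-incident x Q v w (inj₁ refl)) (trans (cong -_ (iso w)) (sym (iso w)))
  ... | inj₁ (inj₂ refl) = trans (μ-incident x Q v w (inj₂ refl)) (trans (cong -_ z) (sym z))
    where z = skew-zero {Q} sk (iso v)
  ... | inj₂ (a , b) = μ-no-path x Q v w a b (inj₂ (iso w))

  -- Local finiteness as finite support of rows

  FiniteRows : Quiver → Set
  FiniteRows Q = ∀ x → Eventually (λ y → Q x y ≡ 0ℤ)

  psum-mono : ∀ f {m n} → m ≤ n → psum f m ≤ psum f n
  psum-mono f {m} {n} m≤n with ℕₚ.m≤n⇒m<n∨m≡n m≤n
  ... | inj₂ refl = ℕₚ.≤-refl
  psum-mono f {m} {suc n} m≤n | inj₁ (s≤s m≤n′) = ℕₚ.≤-trans (psum-mono f m≤n′) (ℕₚ.m≤m+n _ _)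

  psum-stable : ∀ f N → (∀ y → N ≤ y → f y ≡ 0) → ∀ n → psum f n ≤ psum f N
  psum-stable f N z n with ℕₚ.≤-total n N
  ... | inj₁ n≤N = psum-mono f n≤N
  ... | inj₂ N≤n = subst (λ k → psum f k ≤ psum f N) (ℕₚ.m+[n∸m]≡n N≤n) (beyond (n ℕ.∸ N))
    where
    beyond : ∀ k → psum f (N ℕ.+ k) ≤ psum f N
    beyond zero = ℕₚ.≤-reflexive (cong (psum f) (ℕₚ.+-identityʳ N))
    beyond (suc k) rewrite ℕₚ.+-suc N k | z (N ℕ.+ k) (ℕₚ.m≤m+n N k) | ℕₚ.+-identityʳ (psum f (N ℕ.+ k)) = beyond k

  psum-unbounded : ∀ f → Unbounded (λ y → f y ≢ 0) → ∀ B → ∃[ n ] B ≤ psum f n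
  psum-unbounded f unb zero = 0 , z≤n
  psum-unbounded f unb (suc B) with psum-unbounded f unb B
  ... | n , B≤ with unb n
  ...   | y , n≤y , fy≢0 = suc y ,
    subst (ℕ._≤ psum f y ℕ.+ f y) (ℕₚ.+-comm B 1)
      (ℕₚ.+-mono-≤ (ℕₚ.≤-trans B≤ (psum-mono f n≤y)) (ℕₚ.n≢0⇒n>0 fy≢0))

  finiteRows⇒locFin : ∀ {Q} → FiniteRows Q → LocallyFinite Q
  finiteRows⇒locFin {Q} fr x with fr x
  ... | N , z = psum f N , psum-stable f N (λ y le → cong ∣_∣ (z y le))
    where f = λ y → ∣ Q x y ∣

  -- Nonzero integers have absolute value at least 1, so infinitely many of them in a row would make
  -- its partial sums unbounded. Finite support is the form that mutation visibly preserves.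
  locFin⇒finiteRows : ∀ {Q} → LocallyFinite Q → FiniteRows Q
  locFin⇒finiteRows {Q} lf x with lf x
  ... | B , bdd with ¬unbounded⇒eventually¬ {P = λ y → ∣ Q x y ∣ ≢ 0} (λ unb →
         let n , le = psum-unbounded (λ y → ∣ Q x y ∣) unb (suc B) in ℕₚ.<-irrefl refl (ℕₚ.≤-trans le (bdd n)))
  ...   | N , h = N , λ y le → ℤₚ.∣i∣≡0⇒i≡0 (dne (h y le))

  μ-finiteRows : ∀ x {Q} → FiniteRows Q → FiniteRows (μ x Q)
  μ-finiteRows x {Q} fr v with fr v | fr x
  ... | N , z | N′ , z′ = N ℕ.⊔ N′ , λ w le →
    μ-zero x Q v w (z w (ℕₚ.≤-trans (ℕₚ.m≤m⊔n N N′) le))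
                   (inj₂ (z′ w (ℕₚ.≤-trans (ℕₚ.m≤n⊔m N N′) le)))

  _⊕_ : LFQuiver → LFQuiver → LFQuiver
  P ⊕ G = mkLF (λ u v → quiver P u v + quiver G u v)
    (λ u v → trans (cong₂ _+_ (skew P u v) (skew G u v)) (sym (ℤₚ.neg-distrib-+ (quiver P v u) (quiver G v u))))
    (finiteRows⇒locFin λ u →
      let N , z = locFin⇒finiteRows {quiver P} (locFin P) u
          N′ , z′ = locFin⇒finiteRows {quiver G} (locFin G) u
      in N ℕ.⊔ N′ , λ v le → cong₂ _+_ (z v (ℕₚ.≤-trans (ℕₚ.m≤m⊔n N N′) le))
                                       (z′ v (ℕₚ.≤-trans (ℕₚ.m≤n⊔m N N′) le)))

  -- Overfills and basic open sets

  overfill-on : ∀ V Q x y → x ∈ V ⊎ y ∈ V → overfill V Q x y ≡ Q x y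
  overfill-on V Q x y h with x ∈? V | y ∈? V
  ... | yes _ | _ = refl
  ... | no _ | yes _ = refl
  overfill-on V Q x y (inj₁ e) | no n | no _ = ⊥-elim (n e)
  overfill-on V Q x y (inj₂ e) | no _ | no n = ⊥-elim (n e)

  overfill-off : ∀ V Q x y → ¬ (x ∈ V) → ¬ (y ∈ V) → overfill V Q x y ≡ 0ℤ
  overfill-off V Q x y m n with x ∈? V | y ∈? V
  ... | yes e | _ = ⊥-elim (m e)
  ... | no _ | yes e = ⊥-elim (n e)
  ... | no _ | no _ = refl

  overfill-≐ : ∀ V {Q Q′} → IsSkew Q → IsSkew Q′ → (∀ x → x ∈ V → ∀ y → Q x y ≡ Q′ x y) →
    overfill V Q ≐ overfill V Q′
  overfill-≐ V {Q} {Q′} sk sk′ h x y with x ∈? V | y ∈? V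
  ... | yes x∈ | _ = h x x∈ y
  ... | no _ | yes y∈ = trans (sk x y) (trans (cong -_ (h y y∈ x)) (sym (sk′ x y)))
  ... | no _ | no _ = refl

  overfill-row : ∀ {V Q Q′} → overfill V Q ≐ overfill V Q′ → ∀ {x} → x ∈ V → ∀ y → Q x y ≡ Q′ x y
  overfill-row {V} {Q} {Q′} h {x} x∈ y =
    trans (sym (overfill-on V Q x y (inj₁ x∈))) (trans (h x y) (overfill-on V Q′ x y (inj₁ x∈)))

  overfill-skew : ∀ V {Q} → IsSkew Q → IsSkew (overfill V Q)
  overfill-skew V {Q} sk x y with x ∈? V | y ∈? V
  ... | yes _ | yes _ = sk x y
  ... | yes _ | no _ = sk x y
  ... | no _ | yes _ = sk x y
  ... | no _ | no _ = refl

  -- Stages of a mutation sequence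

  iterMut-skew : ∀ i {Q} → IsSkew Q → ∀ t → IsSkew (iterMut i Q t)
  iterMut-skew i sk zero = sk
  iterMut-skew i sk (suc t) = μ-skew (i t) (iterMut-skew i sk t)

  iterMut-finiteRows : ∀ i {Q} → FiniteRows Q → ∀ t → FiniteRows (iterMut i Q t)
  iterMut-finiteRows i fr zero = fr
  iterMut-finiteRows i fr (suc t) = μ-finiteRows (i t) (iterMut-finiteRows i fr t)

  iterMut-isolated : ∀ i {Q v} → Isolated Q v → ∀ t → Isolated (iterMut i Q t) v
  iterMut-isolated i iso zero = iso
  iterMut-isolated i {Q} {v} iso (suc t) =
    μ-isolated (i t) (iterMut i Q t) {v} (iterMut-isolated i {Q} {v} iso t)

  iterMut-isolated⁻ : ∀ i {Q v} t → Isolated (iterMut i Q t) v → Isolated Q v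
  iterMut-isolated⁻ i zero iso = iso
  iterMut-isolated⁻ i {Q} {v} (suc t) iso =
    iterMut-isolated⁻ i {Q} {v} t (μ-isolated⁻ (i t) (iterMut i Q t) {v} iso)

  i≡-i⇒i≡0 : ∀ {a} → a ≡ - a → a ≡ 0ℤ
  i≡-i⇒i≡0 {+ zero} _ = refl
  i≡-i⇒i≡0 {+ suc _} ()
  i≡-i⇒i≡0 { -[1+ _ ]} ()

  convergent⇒isolated : ∀ i (Q : LFQuiver) {v} → InfOften i v → 𝒞 i Q → Isolated (quiver Q) v
  convergent⇒isolated i Q {v} inf (L , conv) with conv (v ∷ [])
  -- Convergence controls stages `suc n` only. A position from `suc M` on is a successor, so the
  -- stages before and after its mutation are both controlled.
  ... | M , stable with inf (suc M)
  ...   | suc m , s≤s M≤m , im≡v = iterMut-isolated⁻ i {quiver Q} {v} (suc m) λ w →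
    i≡-i⇒i≡0 (trans (row m M≤m w)
      (trans (sym (row (suc m) (ℕₚ.m≤n⇒m≤1+n M≤m) w)) (μ-incident _ (iterMut i (quiver Q) (suc m)) v w (inj₁ im≡v))))
    where
    row : ∀ n → M ≤ n → ∀ w → iterMut i (quiver Q) (suc n) v w ≡ quiver L v w
    row n le = overfill-row (stable n le) (here refl)

  -- Block reduction

  -- An action of the free product of copies of ℤ/2, up to an equivalence. Block reduction is
  -- studied at this generality because it is applied to two actions: on quivers for convergence, on
  -- reduced words for divergence.
  record InvolutiveAction : Set₁ where
    field
      Carrier : Set
      _≈_ : Carrier → Carrier → Set
      ≈-refl : ∀ {x} → x ≈ x
      ≈-sym : ∀ {x y} → x ≈ y → y ≈ x
      ≈-trans : ∀ {x y z} → x ≈ y → y ≈ z → x ≈ z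
      act : ℕ → Carrier → Carrier
      act-cong : ∀ a {x y} → x ≈ y → act a x ≈ act a y
      act-involutive : ∀ a x → act a (act a x) ≈ x

  -- Makes the parity of a block independent of the list that witnesses it.
  unique-length : ∀ {l l′ : List ℕ} → Unique l → Unique l′ →
    (∀ q → (q ∈ l → q ∈ l′) × (q ∈ l′ → q ∈ l)) → length l ≡ length l′
  unique-length u u′ h =
    ↭-length (∼bag⇒↭ (unique∧set⇒bag u u′ λ {q} → mk⇔ (proj₁ (h q)) (proj₂ (h q))))

  even∨odd : ∀ n → (∃[ k ] n ≡ 2 ℕ.* k) ⊎ Odd n
  even∨odd zero = inj₁ (0 , refl)
  even∨odd (suc n) with even∨odd n
  ... | inj₁ (k , e) = inj₂ (k , cong suc e)
  ... | inj₂ (k , e) = inj₁ (suc k , trans (cong suc e) (sym (ℕₚ.*-suc 2 k)))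

  module _ (s : ℕ → ℕ) where

    -- In other words, no block of `K` has entries both before `c` and from `c` on, so the letters
    -- read before `c` form whole blocks.
    Cut : (ℕ → Set) → ℕ → Set
    Cut K c = ∀ r q → K r → r < c → c ≤ q → K q → (∀ t → r < t → t < q → ¬ K t) → s r ≢ s q

    blockStart⇒cut : ∀ {K p} → BlockStart s K p → Cut K p
    blockStart⇒cut {K} {p} (Kp , start) r q Kr r<p p≤q Kq gap with ℕₚ.m≤n⇒m<n∨m≡n p≤q
    ... | inj₁ p<q = ⊥-elim (gap p r<p p<q Kp)
    ... | inj₂ refl = start r (Kr , r<p , gap)

    Reduce : (ℕ → Set) → ℕ → Set
    Reduce K p = BlockStart s K p × HasOddCard (InBlock s K p)

    -- A position that reaches stage `m` is thus a cut of all earlier stages at once, which allows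
    -- their states to be compared there.
    kseq⇒blockStart : ∀ {K₀ p} m → Kseq s K₀ m p → ∀ j → j < m → BlockStart s (Kseq s K₀ j) p
    kseq⇒blockStart (suc m) (bs , _) j (s≤s j≤m) with ℕₚ.m≤n⇒m<n∨m≡n j≤m
    ... | inj₁ j<m = kseq⇒blockStart m (proj₁ bs) j j<m
    ... | inj₂ refl = bs

    kseq-antitone : ∀ {K₀ p j} m → j ≤ m → Kseq s K₀ m p → Kseq s K₀ j p
    kseq-antitone m j≤m Kp with ℕₚ.m≤n⇒m<n∨m≡n j≤m
    ... | inj₁ j<m = proj₁ (kseq⇒blockStart m Kp _ j<m)
    ... | inj₂ refl = Kp

    module _ (A : InvolutiveAction) where
      open InvolutiveAction A

      step : {P : Set} → Dec P → ℕ → Carrier → Carrier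
      step (yes _) t x = act (s t) x
      step (no _) t x = x

      run : (ℕ → Set) → ℕ → Carrier → Carrier
      run P zero x = x
      run P (suc t) x = step (em {P t}) t (run P t x)

      run-yes : ∀ {P t} x → P t → run P (suc t) x ≡ act (s t) (run P t x)
      run-yes {P} {t} x Pt with em {P t}
      ... | yes _ = refl
      ... | no ¬Pt = ⊥-elim (¬Pt Pt)

      run-no : ∀ {P t} x → ¬ P t → run P (suc t) x ≡ run P t x
      run-no {P} {t} x ¬Pt with em {P t}
      ... | yes Pt = ⊥-elim (¬Pt Pt)
      ... | no _ = refl

      ≡⇒≈ : ∀ {x y} → x ≡ y → x ≈ y
      ≡⇒≈ refl = ≈-refl

      run-cong : ∀ {P P′} x x′ t → x ≈ x′ → (∀ q → q < t → (P q → P′ q) × (P′ q → P q)) →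
        run P t x ≈ run P′ t x′
      run-cong x x′ zero h _ = h
      run-cong {P} {P′} x x′ (suc t) h same with run-cong {P} {P′} x x′ t h (λ q q<t → same q (ℕₚ.m<n⇒m<1+n q<t))
                                            | em {P t} | em {P′ t}
      ... | ih | yes _ | yes _ = act-cong (s t) ih
      ... | ih | no _ | no _ = ih
      ... | ih | yes p | no n = ⊥-elim (n (proj₁ (same t ℕₚ.≤-refl) p))
      ... | ih | no n | yes p = ⊥-elim (n (proj₂ (same t ℕₚ.≤-refl) p))

      run-skip : ∀ {P} x t t′ → t ≤ t′ → (∀ q → t ≤ q → q < t′ → ¬ P q) → run P t′ x ≡ run P t x
      run-skip x t zero z≤n _ = refl
      run-skip {P} x t (suc t′) le h with ℕₚ.m≤n⇒m<n∨m≡n le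
      ... | inj₂ refl = refl
      ... | inj₁ (s≤s le′) = trans (run-no {P} x (h t′ le′ ℕₚ.≤-refl))
          (run-skip {P} x t t′ le′ λ q a b → h q a (ℕₚ.m<n⇒m<1+n b))

      -- Letters act invertibly, so an initial state can be fitted to any state prescribed at time
      -- `t`.
      run-surjective : ∀ {P} t y → ∃[ x ] run P t x ≈ y
      run-surjective zero y = y , ≈-refl
      run-surjective {P} (suc t) y with em {P t}
      ... | no _ = run-surjective t y
      ... | yes _ with run-surjective {P} t (act (s t) y)
      ...   | x , h = x , ≈-trans (act-cong (s t) h) (act-involutive (s t) y)

      toggles : ℕ → ℕ → Carrier → Carrier
      toggles zero a x = x
      toggles (suc n) a x = act a (toggles n a x)

      toggles-even : ∀ k a x → toggles (2 ℕ.* k) a x ≈ x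
      toggles-even zero a x = ≈-refl
      toggles-even (suc k) a x rewrite ℕₚ.+-suc k (k ℕ.+ 0) =
        ≈-trans (act-involutive a _) (toggles-even k a x)

      module _ {K : ℕ → Set} (x : Carrier) where

        -- Halfway through the block starting at b: e is the last position of K read so
        -- far, l lists the positions of the block read so far, y is the state before b.
        record Inside (t : ℕ) : Set where
          field
            b e : ℕ
            l : List ℕ
            y : Carrier
            start : BlockStart s K b
            b≤e : b ≤ e
            e<t : e < t
            Ke : K e
            gap : ∀ u → e < u → u < t → ¬ K u
            constant : ∀ u → b ≤ u → u < t → K u → s u ≡ s b
            unique : Unique l
            members : ∀ q → (q ∈ l → K q × b ≤ q × q < t) × (K q → b ≤ q → q < t → q ∈ l)
            runK : run K t x ≈ toggles (length l) (s b) y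
            runR : run (Reduce K) t x ≈ step (em {Reduce K b}) b y

        -- The reduced run acted at `b` according to the parity of the whole block. At a cut the
        -- block has been read completely, so `l` has that parity: an even number of toggles
        -- cancels, an odd number leaves one.
        finish : ∀ {t} → Inside t → Cut K t → run K t x ≈ run (Reduce K) t x
        finish {t} I cut = ≈-trans runK (≈-trans parity (≈-sym runR))
          where
          open Inside I
          -- If the block went beyond `t`, the first entry of `K` from `t` on would carry the letter
          -- of `e`, against `cut`.
          read : ∀ q → InBlock s K b q → q < t
          read q (Kq , b≤q , const) with q <? t
          ... | yes q<t = q<t
          ... | no q≮t with least {λ q′ → K q′ × t ≤ q′} (Kq , ℕₚ.≮⇒≥ q≮t)
          ...   | q′ , q′≤q , (Kq′ , t≤q′) , first = ⊥-elim
            (cut e q′ Ke e<t t≤q′ Kq′ none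
               (trans (constant e b≤e e<t Ke) (sym (const q′ (ℕₚ.≤-trans b≤e (ℕₚ.<⇒≤ (ℕₚ.<-≤-trans e<t t≤q′))) q′≤q Kq′))))
            where
            none : ∀ u → e < u → u < q′ → ¬ K u
            none u e<u u<q′ Ku with u <? t
            ... | yes u<t = gap u e<u u<t Ku
            ... | no u≮t = first u u<q′ (Ku , ℕₚ.≮⇒≥ u≮t)
          complete : ∀ q → (InBlock s K b q → q ∈ l) × (q ∈ l → InBlock s K b q)
          complete q = (λ i → proj₂ (members q) (proj₁ i) (proj₁ (proj₂ i)) (read q i)) ,
            λ q∈ → let Kq , b≤q , q<t = proj₁ (members q) q∈ in
              Kq , b≤q , λ u b≤u u≤q Ku → constant u b≤u (ℕₚ.≤-<-trans u≤q q<t) Ku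
          parity : toggles (length l) (s b) y ≈ step (em {Reduce K b}) b y
          parity with em {Reduce K b} | even∨odd (length l)
          ... | yes _ | inj₂ (k , e′) rewrite e′ = act-cong (s b) (toggles-even k (s b) y)
          ... | no _ | inj₁ (k , e′) rewrite e′ = toggles-even k (s b) y
          ... | no ¬R | inj₂ odd = ⊥-elim (¬R (start , l , unique , odd , complete))
          ... | yes (_ , l′ , u′ , (k′ , odd′) , mem′) | inj₁ (k , e′) = ⊥-elim
            (ℕₚ.even≢odd k k′ (trans (sym e′) (trans
              (unique-length unique u′ λ q → (λ q∈ → proj₁ (mem′ q) (proj₂ (complete q) q∈)) ,
                                             (λ q∈ → proj₁ (complete q) (proj₂ (mem′ q) q∈))) odd′)))

        Untouched : ℕ → Set
        Untouched t = (∀ q → q < t → ¬ K q) × (run K t x ≈ x) × (run (Reduce K) t x ≈ x)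

        enter : ∀ {t} → K t → BlockStart s K t → run K t x ≈ run (Reduce K) t x → Inside (suc t)
        enter {t} Kt bs same = record
          { b = t ; e = t ; l = t ∷ [] ; y = run (Reduce K) t x
          ; start = bs ; b≤e = ℕₚ.≤-refl ; e<t = ℕₚ.≤-refl ; Ke = Kt
          ; gap = λ u a b → ⊥-elim (ℕₚ.<⇒≱ a (ℕₚ.≤-pred b))
          ; constant = λ u a b _ → cong s (ℕₚ.≤-antisym (ℕₚ.≤-pred b) a)
          ; unique = All.[] ∷ []
          ; members = λ q → (λ { (here refl) → Kt , ℕₚ.≤-refl , ℕₚ.≤-refl }) ,
                            λ _ a b → here (ℕₚ.≤-antisym (ℕₚ.≤-pred b) a)
          ; runK = ≈-trans (≡⇒≈ (run-yes {K} x Kt)) (act-cong (s t) same)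
          ; runR = ≈-refl }

        advance : ∀ t → Untouched t ⊎ Inside t → Untouched (suc t) ⊎ Inside (suc t)
        advance t state with classical (K t)
        advance t (inj₁ (none , a , b)) | inj₂ ¬Kt = inj₁
          ( (λ q q<st → case ℕₚ.m≤n⇒m<n∨m≡n (ℕₚ.≤-pred q<st) of λ where
               (inj₁ q<t) → none q q<t
               (inj₂ refl) → ¬Kt)
          , ≈-trans (≡⇒≈ (run-no {K} x ¬Kt)) a , ≈-trans (≡⇒≈ (run-no {Reduce K} x (¬Kt ∘ proj₁ ∘ proj₁))) b)
        advance t (inj₁ (none , a , b)) | inj₁ Kt =
          inj₂ (enter Kt (Kt , λ r (Kr , r<t , _) → ⊥-elim (none r r<t Kr)) (≈-trans a (≈-sym b)))
        advance t (inj₂ I) | inj₂ ¬Kt = inj₂ record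
          { b = b ; e = e ; l = l ; y = y ; start = start ; b≤e = b≤e
          ; e<t = ℕₚ.m<n⇒m<1+n e<t ; Ke = Ke
          ; gap = λ u e<u u<st Ku → gap u e<u (below u u<st Ku) Ku
          ; constant = λ u b≤u u<st Ku → constant u b≤u (below u u<st Ku) Ku
          ; unique = unique
          ; members = λ q → (λ q∈ → let Kq , b≤q , q<t = proj₁ (members q) q∈ in Kq , b≤q , ℕₚ.m<n⇒m<1+n q<t)
                          , λ Kq b≤q q<st → proj₂ (members q) Kq b≤q (below q q<st Kq)
          ; runK = ≈-trans (≡⇒≈ (run-no {K} x ¬Kt)) runK
          ; runR = ≈-trans (≡⇒≈ (run-no {Reduce K} x (¬Kt ∘ proj₁ ∘ proj₁))) runR }
          where
          open Inside I
          below : ∀ u → u < suc t → K u → u < t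
          below u u<st Ku with ℕₚ.m≤n⇒m<n∨m≡n (ℕₚ.≤-pred u<st)
          ... | inj₁ u<t = u<t
          ... | inj₂ refl = ⊥-elim (¬Kt Ku)
        advance t (inj₂ I) | inj₁ Kt with s t ≟ s (Inside.b I)
        ... | no differ = inj₂ (enter Kt bs (finish I (blockStart⇒cut bs)))
          where
          open Inside I
          bs : BlockStart s K t
          bs = Kt , λ r (Kr , r<t , none) sr≡st → case ℕₚ.<-cmp r e of λ where
            (tri< r<e _ _) → none e r<e e<t Ke
            (tri≈ _ refl _) → differ (trans (sym sr≡st) (constant e b≤e e<t Ke))
            (tri> _ _ e<r) → gap r e<r r<t Kr
        ... | yes same = inj₂ record
          { b = b ; e = t ; l = t ∷ l ; y = y ; start = start ; b≤e = b≤t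
          ; e<t = ℕₚ.≤-refl ; Ke = Kt
          ; gap = λ u a c → ⊥-elim (ℕₚ.<⇒≱ a (ℕₚ.≤-pred c))
          ; constant = λ u b≤u u<st Ku → case ℕₚ.m≤n⇒m<n∨m≡n (ℕₚ.≤-pred u<st) of λ where
              (inj₁ u<t) → constant u b≤u u<t Ku
              (inj₂ refl) → same
          ; unique = All.tabulate (λ {q} q∈ t≡q → ℕₚ.<-irrefl (sym t≡q) (proj₂ (proj₂ (proj₁ (members q) q∈)))) ∷ unique
          ; members = λ q →
              (λ { (here refl) → Kt , b≤t , ℕₚ.≤-refl
                 ; (there q∈) → let Kq , b≤q , q<t = proj₁ (members q) q∈ in Kq , b≤q , ℕₚ.m<n⇒m<1+n q<t }) ,
              λ Kq b≤q q<st → case ℕₚ.m≤n⇒m<n∨m≡n (ℕₚ.≤-pred q<st) of λ where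
                (inj₁ q<t) → there (proj₂ (members q) Kq b≤q q<t)
                (inj₂ q≡t) → here q≡t
          ; runK = ≈-trans (≡⇒≈ (run-yes {K} x Kt)) (≈-trans (≡⇒≈ (cong (λ a → act a (run K t x)) same)) (act-cong (s b) runK))
          ; runR = ≈-trans (≡⇒≈ (run-no {Reduce K} x ¬Rt)) runR }
          where
          open Inside I
          b≤t : b ≤ t
          b≤t = ℕₚ.<⇒≤ (ℕₚ.≤-<-trans b≤e e<t)
          ¬Rt : ¬ Reduce K t
          ¬Rt ((_ , start′) , _) = start′ e (Ke , e<t , gap) (trans (constant e b≤e e<t Ke) (sym same))

        progress : ∀ t → Untouched t ⊎ Inside t
        progress zero = inj₁ ((λ _ ()) , ≈-refl , ≈-refl)
        progress (suc t) = advance t (progress t)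

        run-reduce : ∀ {t} → Cut K t → run K t x ≈ run (Reduce K) t x
        run-reduce {t} cut with progress t
        ... | inj₁ (_ , a , b) = ≈-trans a (≈-sym b)
        ... | inj₂ I = finish I cut

      -- Passing to the next stage preserves the state at a cut, so a common cut of the first `m`
      -- stages sees the same state in all of them.
      run-kseq : ∀ {K₀ t} x m → (∀ j → j < m → Cut (Kseq s K₀ j) t) →
        run K₀ t x ≈ run (Kseq s K₀ m) t x
      run-kseq x zero _ = ≈-refl
      run-kseq x (suc m) cuts = ≈-trans (run-kseq x m (λ j j<m → cuts j (ℕₚ.m<n⇒m<1+n j<m)))
                                        (run-reduce x (cuts m ℕₚ.≤-refl))

  -- Convergence

  ≐-trans : ∀ {Q Q′ Q″} → Q ≐ Q′ → Q′ ≐ Q″ → Q ≐ Q″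
  ≐-trans h h′ v w = trans (h v w) (h′ v w)

  ≐-sym : ∀ {Q Q′} → Q ≐ Q′ → Q′ ≐ Q
  ≐-sym h v w = sym (h v w)

  mutations : InvolutiveAction
  mutations = record
    { Carrier = Quiver
    ; _≈_ = _≐_
    ; ≈-refl = λ _ _ → refl
    ; ≈-sym = ≐-sym
    ; ≈-trans = ≐-trans
    ; act = μ
    ; act-cong = λ a → μ-cong a
    ; act-involutive = μ-involutive }

  iterMutLF : (ℕ → ℕ) → LFQuiver → ℕ → LFQuiver
  iterMutLF i Q t = mkLF (iterMut i (quiver Q) t) (iterMut-skew i (skew Q) t)
    (finiteRows⇒locFin (iterMut-finiteRows i (locFin⇒finiteRows {quiver Q} (locFin Q)) t))

  eventually-all : {R : ℕ → ℕ → Set} (V : List ℕ) → (∀ x → Eventually (R x)) →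
    Eventually (λ m → ∀ x → x ∈ V → R x m)
  eventually-all [] h = 0 , λ _ _ _ ()
  eventually-all {R} (v ∷ V) h with h v | eventually-all {R} V h
  ... | T , f | T′ , g = T ℕ.⊔ T′ , λ m le x → λ where
    (here refl) → f m (ℕₚ.≤-trans (ℕₚ.m≤m⊔n T T′) le)
    (there x∈) → g m (ℕₚ.≤-trans (ℕₚ.m≤n⊔m T T′) le) x x∈

  -- Once the sequence returns to Q* at a time after which neither x nor its neighbours in Q*
  -- are mutated any more, row x is frozen.
  recurrent⇒convergent : ∀ i (Q Q* : LFQuiver) →
    Unbounded (λ t → iterMut i (quiver Q) t ≐ quiver Q*) →
    (∀ v → Isolated (quiver Q*) v ⊎ Eventually (λ m → i m ≢ v)) → 𝒞 i Q
  recurrent⇒convergent i Q Q* rec finite = Q* , λ V →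
    let M , f = eventually-all {λ x m → ∀ y → iterMut i (quiver Q) m x y ≡ quiver Q* x y} V row in
    M , λ m le → overfill-≐ V (iterMut-skew i (skew Q) (suc m)) (skew Q*)
                   (f (suc m) (ℕₚ.m≤n⇒m≤1+n le))
    where
    q = iterMut i (quiver Q)
    q* = quiver Q*
    R : ℕ → ℕ → Set
    R v m = Isolated q* v ⊎ i m ≢ v
    finiteR : ∀ v → Eventually (R v)
    finiteR v with finite v
    ... | inj₁ iso = 0 , λ _ _ → inj₁ iso
    ... | inj₂ (T , f) = T , λ m le → inj₂ (f m le)
    row : ∀ x → Eventually (λ m → ∀ y → q m x y ≡ q* x y)
    row x with locFin⇒finiteRows {q*} (locFin Q*) x
    ... | B , zeros with eventually-below {R} (B ℕ.⊔ suc x) (λ v _ → finiteR v)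
    -- This bound exceeds `x` and its neighbours in `Q*`. After `T`, a mutation below it is at an
    -- isolated vertex, and a mutation beyond it is at a vertex without arrows to `x`.
    ...   | T , late with rec T
    ...     | p , T≤p , returns = p , λ m p≤m →
                subst (λ k → ∀ y → q k x y ≡ q* x y) (ℕₚ.m+[n∸m]≡n p≤m) (proj₁ (frozen (m ℕ.∸ p)))
      where
      C = B ℕ.⊔ suc x
      frozen : ∀ n → (∀ y → q (p ℕ.+ n) x y ≡ q* x y) × (∀ v → Isolated q* v → Isolated (q (p ℕ.+ n)) v)
      frozen zero rewrite ℕₚ.+-identityʳ p = returns x , λ v → isolated-cong {v = v} (≐-sym returns)
      frozen (suc n) rewrite ℕₚ.+-suc p n with frozen n
      ... | same , iso = same′ , λ v → μ-isolated w (q t) {v} ∘ iso v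
        where
        t = p ℕ.+ n
        w = i t
        late-w : w < C → Isolated q* w
        late-w w<C with late t (ℕₚ.≤-trans T≤p (ℕₚ.m≤m+n p n)) w w<C
        ... | inj₁ iso′ = iso′
        ... | inj₂ ≢w = ⊥-elim (≢w refl)
        same′ : ∀ y → μ w (q t) x y ≡ q* x y
        same′ y with w <? C
        ... | yes w<C = trans (μ-at-isolated {w} {q t} (iterMut-skew i (skew Q) t) (iso w (late-w w<C)) x y) (same y)
        ... | no w≮C with classical (w ≡ y)
        ...   | inj₁ refl = trans (μ-incident w (q t) x w (inj₂ refl))
                  (trans (cong -_ (trans (same w) w-far)) (sym w-far))
          where w-far = zeros w (ℕₚ.≤-trans (ℕₚ.m≤m⊔n B (suc x)) (ℕₚ.≮⇒≥ w≮C))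
        ...   | inj₂ w≢y = trans (μ-no-path w (q t) x y
                    (λ { refl → w≮C (ℕₚ.m≤n⊔m B (suc x)) }) w≢y (inj₁ (trans (same w)
                      (zeros w (ℕₚ.≤-trans (ℕₚ.m≤m⊔n B (suc x)) (ℕₚ.≮⇒≥ w≮C)))))) (same y)

  -- Mutations at vertices from `M` on do nothing, and those at the finitely many vertices below `M`
  -- come to an end, so the sequence is eventually constant.
  finiteSupport⇒convergent : ∀ i (Q : LFQuiver) → SinfEmpty i →
    ∀ M → (∀ v → M ≤ v → Isolated (quiver Q) v) → 𝒞 i Q
  finiteSupport⇒convergent i Q none M iso
    with eventually-below {λ v m → i m ≢ v} M (λ v _ → finOften⇒eventually≢ (none v))
  ... | T , late = recurrent⇒convergent i Q (iterMutLF i Q T) constant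
          (λ v → inj₂ (finOften⇒eventually≢ (none v)))
    where
    q = iterMut i (quiver Q)
    constant-from : ∀ n → q (T ℕ.+ n) ≐ q T
    constant-from zero rewrite ℕₚ.+-identityʳ T = λ _ _ → refl
    constant-from (suc n) rewrite ℕₚ.+-suc T n = ≐-trans
      (μ-at-isolated {i (T ℕ.+ n)} {q (T ℕ.+ n)} (iterMut-skew i (skew Q) (T ℕ.+ n))
        (iterMut-isolated i {quiver Q} {i (T ℕ.+ n)} (iso _ (ℕₚ.≮⇒≥ λ lt → late (T ℕ.+ n) (ℕₚ.m≤m+n T n) _ lt refl)) (T ℕ.+ n)))
      (constant-from n)
    constant : Unbounded (λ t → q t ≐ q T)
    constant n = T ℕ.+ n , ℕₚ.m≤n+m n T , constant-from n

  -- Recurrence of a state when the reduction is finite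

  module _ (s : ℕ → ℕ) (K : ℕ → Set)
           (finite : ∀ v → Eventually (λ m → K m → s m ≢ v)) where

    -- The letter of an entry `e` eventually disappears, and the first later entry with another
    -- letter starts a block.
    blockStarts-unbounded : ∀ m → Unbounded (Kseq s K m) → Unbounded (BlockStart s (Kseq s K m))
    blockStarts-unbounded m unb n with unb n
    ... | e , n≤e , Ke with finite (s e)
    ...   | T , away with unb (T ℕ.⊔ suc e)
    ...     | q , T≤q , Kq with least {λ p → Kseq s K m p × e < p × s p ≢ s e}
                  (Kq , ℕₚ.≤-trans (ℕₚ.m≤n⊔m T (suc e)) T≤q
                      , away q (ℕₚ.≤-trans (ℕₚ.m≤m⊔n T (suc e)) T≤q) (kseq-antitone s {K} {q} m z≤n Kq))
    ...       | p , _ , (Kp , e<p , sp≢se) , first =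
      p , ℕₚ.≤-trans n≤e (ℕₚ.<⇒≤ e<p) , Kp , λ r (Kr , r<p , gap) sr≡sp →
        case ℕₚ.≤-total r e of λ where
          (inj₁ r≤e) → case ℕₚ.m≤n⇒m<n∨m≡n r≤e of λ where
            (inj₁ r<e) → gap e r<e e<p Ke
            (inj₂ refl) → sp≢se (sym sr≡sp)
          (inj₂ e≤r) → case ℕₚ.m≤n⇒m<n∨m≡n e≤r of λ where
            (inj₁ e<r) → first r r<p (Kr , e<r , λ sr≡se → sp≢se (trans (sym sr≡sp) sr≡se))
            (inj₂ refl) → sp≢se (sym sr≡sp)

    -- Each of the finitely many positions below `T` that is not reduced is deleted at some stage,
    -- and deletion is permanent.
    kseq-below : ∀ T → ∃[ m ] (∀ q → q < T → Kseq s K m q → ReducedPos s K q)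
    kseq-below T with eventually-below {λ q m → Kseq s K m q → ReducedPos s K q} T removed
      where
      removed : ∀ q → q < T → Eventually (λ m → Kseq s K m q → ReducedPos s K q)
      removed q _ with classical (ReducedPos s K q)
      ... | inj₁ red = 0 , λ _ _ _ → red
      ... | inj₂ ¬red with ¬∀⇒∃¬ ¬red
      ...   | m , ¬Km = m , λ m′ m≤m′ Km′ → ⊥-elim (¬Km (kseq-antitone s {K} {q} m′ m≤m′ Km′))
    ... | m , h = m , h m ℕₚ.≤-refl

    module _ (A : InvolutiveAction) (x : InvolutiveAction.Carrier A) where
      open InvolutiveAction A

      Recurs : Carrier → Set
      Recurs x* = Unbounded (λ t → run s A K t x ≈ x*)

      -- Choose a stage `m` with only reduced positions left below `n ⊔ N`, and its first position
      -- `p` from there on. Before `p` this stage reads exactly the reduced positions, all of which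
      -- lie below `N`; and `p` is a cut of the stages before `m`.
      recurs-reduced : ReductionFinite s K → (∀ m → Unbounded (Kseq s K m)) → ∃[ x* ] Recurs x*
      recurs-reduced (N , redN) unb = run s A (ReducedPos s K) N x , recurs
        where
        recurs : Recurs (run s A (ReducedPos s K) N x)
        recurs n with kseq-below (n ℕ.⊔ N)
        ... | m , early with unb m (n ℕ.⊔ N)
        ...   | p₀ , T≤p₀ , Kp₀ with least {λ p → Kseq s K m p × n ℕ.⊔ N ≤ p} (Kp₀ , T≤p₀)
        ...     | p , _ , (Kp , T≤p) , first = p , ℕₚ.≤-trans (ℕₚ.m≤m⊔n n N) T≤p ,
          ≈-trans (run-kseq s A x m λ j j<m → blockStart⇒cut s (kseq⇒blockStart s {K} {p} m Kp j j<m))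
          (≈-trans (run-cong s A x x p ≈-refl λ q q<p →
                      (λ Kq → early q (ℕₚ.≰⇒> λ T≤q → first q q<p (Kq , T≤q)) Kq) , λ red → red m)
                   (≡⇒≈ s A (run-skip s A x N p (ℕₚ.≤-trans (ℕₚ.m≤n⊔m n N) T≤p)
                      λ q N≤q _ red → ℕₚ.<⇒≱ (redN q red) N≤q)))

      -- Descend to the first bounded stage. If it is `K` itself, the run becomes constant.
      -- Otherwise the preceding stage has block starts arbitrarily late, and there the run along
      -- `K` agrees with that of the bounded stage, which has become constant.
      recurs-bounded : ∀ m → ¬ Unbounded (Kseq s K m) → ∃[ x* ] Recurs x*
      recurs-bounded m ¬unb with ¬unbounded⇒eventually¬ ¬unb
      recurs-bounded zero ¬unb | T , none = run s A K T x , λ n →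
        n ℕ.⊔ T , ℕₚ.m≤m⊔n n T , ≡⇒≈ s A (run-skip s A x T _ (ℕₚ.m≤n⊔m n T) λ q T≤q _ → none q T≤q)
      recurs-bounded (suc m) ¬unb | T , none with classical (Unbounded (Kseq s K m))
      ... | inj₂ ¬unb′ = recurs-bounded m ¬unb′
      ... | inj₁ unb = run s A (Kseq s K (suc m)) T x , λ n →
        let p , T≤p , bs = blockStarts-unbounded m unb (n ℕ.⊔ T) in
        p , ℕₚ.≤-trans (ℕₚ.m≤m⊔n n T) T≤p ,
        ≈-trans (run-kseq s A x (suc m) (cuts p bs))
          (≡⇒≈ s A (run-skip s A x T p (ℕₚ.≤-trans (ℕₚ.m≤n⊔m n T) T≤p) λ q T≤q _ → none q T≤q))
        where
        cuts : ∀ p → BlockStart s (Kseq s K m) p → ∀ j → j < suc m → Cut s (Kseq s K j) p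
        cuts p bs j (s≤s j≤m) with ℕₚ.m≤n⇒m<n∨m≡n j≤m
        ... | inj₁ j<m = blockStart⇒cut s (kseq⇒blockStart s {K} {p} m (proj₁ bs) j j<m)
        ... | inj₂ refl = blockStart⇒cut s bs

      -- The recurring state is replaced by one at an actual time `t₀`: as a stage of the mutation
      -- sequence it is skew and locally finite, as a limit in LF has to be.
      reductionFinite⇒recurrent : ReductionFinite s K →
        ∃[ t₀ ] Unbounded (λ t → run s A K t x ≈ run s A K t₀ x)
      reductionFinite⇒recurrent fin = from recurring
        where
        recurring : ∃[ x* ] Recurs x*
        recurring with classical (∀ m → Unbounded (Kseq s K m))
        ... | inj₁ unb = recurs-reduced fin unb
        ... | inj₂ ¬unb = let m , ¬unbₘ = ¬∀⇒∃¬ ¬unb in recurs-bounded m ¬unbₘ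
        from : ∃[ x* ] Recurs x* → ∃[ t₀ ] Unbounded (λ t → run s A K t x ≈ run s A K t₀ x)
        from (x* , rec) = let t₀ , _ , h₀ = rec 0 in t₀ , λ n →
          let t , n≤t , h = rec n in t , n≤t , ≈-trans h (≈-sym h₀)

  iterMut-run : ∀ i (Q : LFQuiver) {K} → (∀ m → ¬ K m → Isolated (quiver Q) (i m)) →
    ∀ t → iterMut i (quiver Q) t ≐ run i mutations K t (quiver Q)
  iterMut-run i Q iso zero v w = refl
  iterMut-run i Q {K} iso (suc t) with em {K t}
  ... | yes _ = μ-cong (i t) (iterMut-run i Q iso t)
  ... | no ¬Kt = ≐-trans (μ-at-isolated {i t} {iterMut i (quiver Q) t} (iterMut-skew i (skew Q) t)
                   (iterMut-isolated i {quiver Q} {i t} (iso t ¬Kt) t)) (iterMut-run i Q iso t)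

  notSinf-finite : ∀ i v → Eventually (λ m → NotSinfPos i m → i m ≢ v)
  notSinf-finite i v with classical (InfOften i v)
  ... | inj₁ inf = 0 , λ m _ ¬inf im≡v → ¬inf (subst (InfOften i) (sym im≡v) inf)
  ... | inj₂ ¬inf = let T , away = finOften⇒eventually≢ ¬inf in T , λ m le _ → away m le

  reductionFinite⇒convergent : ∀ i (Q : LFQuiver) → ReductionFinite i (NotSinfPos i) →
    (∀ v → InfOften i v → Isolated (quiver Q) v) → 𝒞 i Q
  reductionFinite⇒convergent i Q fin iso
    with reductionFinite⇒recurrent i (NotSinfPos i) (notSinf-finite i) mutations (quiver Q) fin
  ... | t₀ , rec = recurrent⇒convergent i Q (iterMutLF i Q t₀)
    (λ n → let t , n≤t , h = rec n in t , n≤t , ≐-trans (as-run t) (≐-trans h (≐-sym (as-run t₀))))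
    settled
    where
    as-run = iterMut-run i Q {NotSinfPos i} λ m ¬¬inf → iso (i m) (dne ¬¬inf)
    settled : ∀ v → Isolated (iterMut i (quiver Q) t₀) v ⊎ Eventually (λ m → i m ≢ v)
    settled v with classical (InfOften i v)
    ... | inj₁ inf = inj₁ (iterMut-isolated i {quiver Q} {v} (iso v inf) t₀)
    ... | inj₂ ¬inf = inj₂ (finOften⇒eventually≢ ¬inf)

  -- Forks

  2ℤ : ℤ
  2ℤ = + 2

  []₊-nonNeg : ∀ {a} → 0ℤ ℤ.≤ a → [ a ]₊ ≡ a
  []₊-nonNeg = ℤₚ.i≥j⇒i⊔j≡i

  []₊-nonPos : ∀ {a} → a ℤ.≤ 0ℤ → [ a ]₊ ≡ 0ℤ
  []₊-nonPos = ℤₚ.i≤j⇒i⊔j≡j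

  path-through : ∀ q {a b} → 0ℤ ℤ.≤ a → 0ℤ ℤ.≤ b → q + a * [ b ]₊ + [ - a ]₊ * b ≡ q + a * b
  path-through q {a} {b} 0≤a 0≤b
    rewrite []₊-nonNeg 0≤b | []₊-nonPos (ℤₚ.neg-mono-≤ 0≤a) = ℤₚ.+-identityʳ _

  path-peak : ∀ q {a b} → 0ℤ ℤ.≤ a → b ℤ.≤ 0ℤ → q + a * [ b ]₊ + [ - a ]₊ * b ≡ q
  path-peak q {a} {b} 0≤a b≤0
    rewrite []₊-nonPos b≤0 | []₊-nonPos (ℤₚ.neg-mono-≤ 0≤a) | ℤₚ.*-zeroʳ a =
      trans (ℤₚ.+-identityʳ _) (ℤₚ.+-identityʳ _)

  path-valley : ∀ q {a b} → a ℤ.≤ 0ℤ → 0ℤ ℤ.≤ b → q + a * [ b ]₊ + [ - a ]₊ * b ≡ q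
  path-valley q {a} {b} a≤0 0≤b
    rewrite []₊-nonNeg 0≤b | []₊-nonNeg (ℤₚ.neg-mono-≤ a≤0) = cancel q a b
    where
    cancel : ∀ q a b → q + a * b + - a * b ≡ q
    cancel = solve-∀

  ≤⇒∃+ : ∀ {i j} → i ℤ.≤ j → ∃[ k ] j ≡ i + + k
  ≤⇒∃+ {i} {j} i≤j = ∣ j ℤ.- i ∣ , sym (trans (cong (λ d → i + d) (ℤₚ.0≤i⇒+∣i∣≡i (ℤₚ.i≤j⇒0≤j-i i≤j))) (back i j))
    where
    back : ∀ i j → i + (j + - i) ≡ j
    back = solve-∀

  i<i+1+k : ∀ i k → i ℤ.< i + (1ℤ + + k)
  i<i+1+k i k = subst (ℤ._< i + (1ℤ + + k)) (ℤₚ.+-identityʳ i) (ℤₚ.+-monoʳ-< i (ℤ.+<+ (s≤s z≤n)))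

  -- The right-hand side is at least `1 + (a - 1) * b`, which exceeds `a` and `b` once both are at
  -- least 2. For `a = b = 1` and `c = 0` it does not. The proof writes `a`, `b`, `c` as their lower
  -- bounds plus naturals, which turns the gaps into polynomials with nonnegative coefficients.
  product-dominates : ∀ {a b c} → 2ℤ ℤ.≤ a → 2ℤ ℤ.≤ b → - b ℤ.< c → a ℤ.< c + a * b × b ℤ.< c + a * b
  product-dominates 2≤a 2≤b -b<c
    with ≤⇒∃+ 2≤a | ≤⇒∃+ 2≤b | ≤⇒∃+ (ℤₚ.i<j⇒suc[i]≤j -b<c)
  ... | m , refl | n , refl | k , refl =
    subst (λ z → _ ℤ.< z) (sym (trans (left (+ m) (+ n) (+ k)) (cong (λ z → 2ℤ + + m + (1ℤ + (+ k + + m + + n + z))) (sym (ℤₚ.pos-* m n)))))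
      (i<i+1+k _ (k ℕ.+ m ℕ.+ n ℕ.+ m ℕ.* n)) ,
    subst (λ z → _ ℤ.< z) (sym (trans (right (+ m) (+ n) (+ k)) (cong (λ z → 2ℤ + + n + (1ℤ + (+ k + + m + + m + z))) (sym (ℤₚ.pos-* m n)))))
      (i<i+1+k _ (k ℕ.+ m ℕ.+ m ℕ.+ m ℕ.* n))
    where
    left : ∀ m n k → (1ℤ + - (2ℤ + n)) + k + (2ℤ + m) * (2ℤ + n) ≡ 2ℤ + m + (1ℤ + (k + m + n + m * n))
    left = solve-∀
    right : ∀ m n k → (1ℤ + - (2ℤ + n)) + k + (2ℤ + m) * (2ℤ + n) ≡ 2ℤ + n + (1ℤ + (k + m + m + m * n))
    right = solve-∀

  0<2 : 0ℤ ℤ.< 2ℤ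
  0<2 = ℤ.+<+ (s≤s z≤n)

  2≤⇒0< : ∀ {a} → 2ℤ ℤ.≤ a → 0ℤ ℤ.< a
  2≤⇒0< = ℤₚ.<-≤-trans 0<2

  Arrow : Quiver → ℕ → ℕ → Set
  Arrow Q u v = 0ℤ ℤ.< Q u v

  module _ {Q : Quiver} (sk : IsSkew Q) where

    arrow-reverse : ∀ {u v} → Arrow Q u v → Q v u ℤ.< 0ℤ
    arrow-reverse {u} {v} 0<uv = subst (ℤ._< 0ℤ) (sym (sk v u)) (ℤₚ.neg-mono-< 0<uv)

    arrow-asym : ∀ {u v} → Arrow Q u v → ¬ Arrow Q v u
    arrow-asym uv vu = ℤₚ.<-asym vu (arrow-reverse uv)

    arrow-irrefl : ∀ {u} → ¬ Arrow Q u u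
    arrow-irrefl uu = arrow-asym uu uu

    arrow-apart : ∀ {u v} → Arrow Q u v → u ≢ v
    arrow-apart uv refl = arrow-irrefl uv

    μ-through : ∀ {k u v} → Arrow Q u k → Arrow Q k v → μ k Q u v ≡ Q u v + Q u k * Q k v
    μ-through {k} {u} {v} uk kv =
      trans (μ-apart k Q u v (arrow-apart uk ∘ sym) (arrow-apart kv))
            (path-through (Q u v) (ℤₚ.<⇒≤ uk) (ℤₚ.<⇒≤ kv))

    μ-peak : ∀ {k u v} → Arrow Q u k → Arrow Q v k → μ k Q u v ≡ Q u v
    μ-peak {k} {u} {v} uk vk =
      trans (μ-apart k Q u v (arrow-apart uk ∘ sym) (arrow-apart vk ∘ sym))
            (path-peak (Q u v) (ℤₚ.<⇒≤ uk) (ℤₚ.<⇒≤ (arrow-reverse vk)))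

    μ-valley : ∀ {k u v} → Arrow Q k u → Arrow Q k v → μ k Q u v ≡ Q u v
    μ-valley {k} {u} {v} ku kv =
      trans (μ-apart k Q u v (arrow-apart ku) (arrow-apart kv))
            (path-valley (Q u v) (ℤₚ.<⇒≤ (arrow-reverse ku)) (ℤₚ.<⇒≤ kv))

    μ-out : ∀ k v → μ k Q k v ≡ Q v k
    μ-out k v = trans (μ-incident k Q k v (inj₁ refl)) (sym (sk v k))

    μ-in : ∀ k u → μ k Q u k ≡ Q k u
    μ-in k u = trans (μ-incident k Q u k (inj₂ refl)) (sym (sk k u))

  -- Warkentin's forks with point of return r; a tournament is acyclic as soon as it has no
  -- oriented triangle.
  record Fork (T : ℕ → Set) (Q : Quiver) (r : ℕ) : Set where
    field
      point : T r
      abundant : ∀ {u v} → T u → T v → u ≢ v → 2ℤ ℤ.≤ Q u v ⊎ 2ℤ ℤ.≤ Q v u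
      acyclic : ∀ {u v w} → T u → T v → T w → u ≢ r → v ≢ r → w ≢ r →
        Arrow Q u v → Arrow Q v w → ¬ Arrow Q w u
      dominated : ∀ {u v} → T u → T v → Arrow Q u r → Arrow Q r v →
        Q u r ℤ.< Q v u × Q r v ℤ.< Q v u

  module _ {T : ℕ → Set} {Q : Quiver} (sk : IsSkew Q) {r : ℕ} (fork : Fork T Q r)
           {k : ℕ} (Tk : T k) (k≢r : k ≢ r) where
    open Fork fork

    private
      Q′ = μ k Q
      sk′ = μ-skew k {Q} sk

    at-least-two : ∀ {u v} → T u → T v → Arrow Q u v → 2ℤ ℤ.≤ Q u v
    at-least-two Tu Tv uv with abundant Tu Tv (arrow-apart {Q} sk uv)
    ... | inj₁ h = h
    ... | inj₂ h = ⊥-elim (arrow-asym {Q} sk uv (2≤⇒0< h))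

    side : ∀ {u} → T u → u ≢ k → Arrow Q u k ⊎ Arrow Q k u
    side Tu u≢k with abundant Tu Tk u≢k
    ... | inj₁ h = inj₁ (2≤⇒0< h)
    ... | inj₂ h = inj₂ (2≤⇒0< h)

    -- An edge from `v` to `u` would oppose the new arrows and close an oriented triangle. The
    -- triangle must contain `r`, and `k ≢ r`, so `r` is `u` or `v`; domination at `r` makes the
    -- opposing edge smaller than one of the two factors, and the product wins.
    through-dominates : ∀ {u v} → T u → T v → Arrow Q u k → Arrow Q k v →
      Q u k ℤ.< Q′ u v × Q k v ℤ.< Q′ u v
    through-dominates {u} {v} Tu Tv uk kv rewrite μ-through {Q} sk uk kv = bound
      where
      2≤a = at-least-two Tu Tk uk
      2≤b = at-least-two Tk Tv kv
      by-right : - Q k v ℤ.< Q u v → Q u k ℤ.< Q u v + Q u k * Q k v × Q k v ℤ.< Q u v + Q u k * Q k v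
      by-right = product-dominates 2≤a 2≤b
      by-left : - Q u k ℤ.< Q u v → Q u k ℤ.< Q u v + Q u k * Q k v × Q k v ℤ.< Q u v + Q u k * Q k v
      by-left h rewrite ℤₚ.*-comm (Q u k) (Q k v) = let p , q = product-dominates 2≤b 2≤a h in q , p
      reversed : ∀ {d} → Q v u ℤ.< d → - d ℤ.< Q u v
      reversed h = subst (λ z → _ ℤ.< z) (sym (sk u v)) (ℤₚ.neg-mono-< h)
      bound : Q u k ℤ.< Q u v + Q u k * Q k v × Q k v ℤ.< Q u v + Q u k * Q k v
      bound with abundant Tu Tv (λ { refl → arrow-asym {Q} sk uk kv })
      ... | inj₁ 2≤uv = by-right (ℤₚ.<-trans (ℤₚ.neg-mono-< kv) (2≤⇒0< 2≤uv))
      ... | inj₂ 2≤vu with u ≟ r | v ≟ r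
      ...   | yes refl | _ = by-right (reversed (proj₁ (dominated Tv Tk (2≤⇒0< 2≤vu) uk)))
      ...   | no _ | yes refl = by-left (reversed (proj₂ (dominated Tk Tu kv (2≤⇒0< 2≤vu))))
      ...   | no u≢r | no v≢r = ⊥-elim (acyclic Tv Tu Tk v≢r u≢r k≢r (2≤⇒0< 2≤vu) uk kv)

    through-arrow : ∀ {u v} → T u → T v → Arrow Q u k → Arrow Q k v → Arrow Q′ u v
    through-arrow Tu Tv uk kv = ℤₚ.<-trans uk (proj₁ (through-dominates Tu Tv uk kv))

    -- Domination along the path from `w` through `r` to `k` gives an arrow from `k` to `w`, against
    -- the one from `w` to `k`. Triangles of a fork pass through `r`, so none lies among the
    -- vertices pointing at `k`.
    no-triangle-into : ∀ {v w} → T v → T w → Arrow Q r k → Arrow Q w k →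
      Arrow Q r v → Arrow Q v w → ¬ Arrow Q w r
    no-triangle-into Tv Tw rk wk rv vw wr =
      arrow-asym {Q} sk wk (ℤₚ.<-trans wr (proj₁ (dominated Tw Tk wr rk)))

    no-triangle-from : ∀ {v w} → T v → T w → Arrow Q k r → Arrow Q k v →
      Arrow Q r v → Arrow Q v w → ¬ Arrow Q w r
    no-triangle-from Tv Tw kr kv rv vw wr =
      arrow-asym {Q} sk kv (ℤₚ.<-trans kr (proj₁ (dominated Tk Tv kr rv)))

    abundant′ : ∀ {u v} → T u → T v → u ≢ v → 2ℤ ℤ.≤ Q′ u v ⊎ 2ℤ ℤ.≤ Q′ v u
    abundant′ {u} {v} Tu Tv u≢v with classical (u ≡ k) | classical (v ≡ k)
    ... | inj₁ refl | _ = subst₂ (λ a b → 2ℤ ℤ.≤ a ⊎ 2ℤ ℤ.≤ b)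
            (sym (μ-out {Q} sk k v)) (sym (μ-in {Q} sk k v)) (swap (abundant Tu Tv u≢v))
    ... | inj₂ _ | inj₁ refl = subst₂ (λ a b → 2ℤ ℤ.≤ a ⊎ 2ℤ ℤ.≤ b)
            (sym (μ-in {Q} sk k u)) (sym (μ-out {Q} sk k u)) (swap (abundant Tu Tv u≢v))
    ... | inj₂ u≢k | inj₂ v≢k with side Tu u≢k | side Tv v≢k
    ...   | inj₁ uk | inj₂ kv = inj₁ (ℤₚ.≤-trans (at-least-two Tu Tk uk) (ℤₚ.<⇒≤ (proj₁ (through-dominates Tu Tv uk kv))))
    ...   | inj₂ ku | inj₁ vk = inj₂ (ℤₚ.≤-trans (at-least-two Tv Tk vk) (ℤₚ.<⇒≤ (proj₁ (through-dominates Tv Tu vk ku))))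
    ...   | inj₁ uk | inj₁ vk rewrite μ-peak {Q} sk uk vk | μ-peak {Q} sk vk uk = abundant Tu Tv u≢v
    ...   | inj₂ ku | inj₂ kv rewrite μ-valley {Q} sk ku kv | μ-valley {Q} sk kv ku = abundant Tu Tv u≢v

    -- After the mutation every edge between the two sides of `k` leads from the vertices that
    -- pointed at `k` to the others. An oriented triangle thus lies on one side, where no entry has
    -- changed.
    acyclic′ : ∀ {u v w} → T u → T v → T w → u ≢ k → v ≢ k → w ≢ k →
      Arrow Q′ u v → Arrow Q′ v w → ¬ Arrow Q′ w u
    acyclic′ {u} {v} {w} Tu Tv Tw u≢k v≢k w≢k uv vw wu with side Tu u≢k | side Tv v≢k | side Tw w≢k
    ... | inj₂ ku | inj₁ vk | _ = arrow-asym {Q′} sk′ uv (through-arrow Tv Tu vk ku)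
    ... | _ | inj₂ kv | inj₁ wk = arrow-asym {Q′} sk′ vw (through-arrow Tw Tv wk kv)
    ... | inj₁ uk | _ | inj₂ kw = arrow-asym {Q′} sk′ wu (through-arrow Tu Tw uk kw)
    ... | inj₁ uk | inj₁ vk | inj₁ wk
        rewrite μ-peak {Q} sk uk vk | μ-peak {Q} sk vk wk | μ-peak {Q} sk wk uk
        with u ≟ r | v ≟ r | w ≟ r
    ...   | yes refl | _ | _ = no-triangle-into Tv Tw uk wk uv vw wu
    ...   | no _ | yes refl | _ = no-triangle-into Tw Tu vk uk vw wu uv
    ...   | no _ | no _ | yes refl = no-triangle-into Tu Tv wk vk wu uv vw
    ...   | no a | no b | no c = acyclic Tu Tv Tw a b c uv vw wu
    acyclic′ {u} {v} {w} Tu Tv Tw u≢k v≢k w≢k uv vw wu | inj₂ ku | inj₂ kv | inj₂ kw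
        rewrite μ-valley {Q} sk ku kv | μ-valley {Q} sk kv kw | μ-valley {Q} sk kw ku
        with u ≟ r | v ≟ r | w ≟ r
    ...   | yes refl | _ | _ = no-triangle-from Tv Tw ku kv uv vw wu
    ...   | no _ | yes refl | _ = no-triangle-from Tw Tu kv kw vw wu uv
    ...   | no _ | no _ | yes refl = no-triangle-from Tu Tv kw ku wu uv vw
    ...   | no a | no b | no c = acyclic Tu Tv Tw a b c uv vw wu

    dominated′ : ∀ {u v} → T u → T v → Arrow Q′ u k → Arrow Q′ k v →
      Q′ u k ℤ.< Q′ v u × Q′ k v ℤ.< Q′ v u
    dominated′ {u} {v} Tu Tv uk kv
      rewrite μ-in {Q} sk k u | μ-out {Q} sk k v =
        let p , q = through-dominates Tv Tu kv uk in q , p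

    fork-μ : Fork T (μ k Q) k
    fork-μ = record { point = Tk ; abundant = abundant′ ; acyclic = acyclic′ ; dominated = dominated′ }

    -- The edge could only be reversed by paths from `y` through `k` to `x`, but these would
    -- complete it to an oriented triangle avoiding `r`.
    arrow-persists : ∀ {x y} → T x → T y → x ≢ r → y ≢ r → x ≢ k → y ≢ k → 2ℤ ℤ.≤ Q x y → 2ℤ ℤ.≤ Q′ x y
    arrow-persists Tx Ty x≢r y≢r x≢k y≢k 2≤xy with side Tx x≢k | side Ty y≢k
    ... | inj₁ xk | inj₂ ky = ℤₚ.≤-trans (at-least-two Tx Tk xk) (ℤₚ.<⇒≤ (proj₁ (through-dominates Tx Ty xk ky)))
    ... | inj₂ kx | inj₁ yk = ⊥-elim (acyclic Tx Ty Tk x≢r y≢r k≢r (2≤⇒0< 2≤xy) yk kx)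
    ... | inj₁ xk | inj₁ yk rewrite μ-peak {Q} sk xk yk = 2≤xy
    ... | inj₂ kx | inj₂ ky rewrite μ-valley {Q} sk kx ky = 2≤xy

  μ* : List ℕ → Quiver → Quiver
  μ* st Q = foldr μ Q st

  μ*-skew : ∀ st {Q} → IsSkew Q → IsSkew (μ* st Q)
  μ*-skew [] sk = sk
  μ*-skew (k ∷ st) sk = μ-skew k (μ*-skew st sk)

  -- `μ*` mutates at the head last, so the bottom letter is the first mutation carried out; it will
  -- be the one at the port.
  bottom : ℕ → List ℕ → ℕ
  bottom k [] = k
  bottom k (k′ ∷ st) = bottom k′ st

  -- The situation just before the first effective mutation. As `p` is the source of the tournament
  -- on `W`, there is a path from `x` through `p` to every other vertex of `W`.
  record Launch (W : ℕ → Set) (Q : Quiver) (x p : ℕ) : Set where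
    field
      isSkew : IsSkew Q
      x∉W : ¬ W x
      p∈W : W p
      x→p : 2ℤ ℤ.≤ Q x p
      x-rest : ∀ v → W v → v ≢ p → Q x v ≡ 0ℤ
      rank : ℕ → ℕ
      rank-injective : ∀ {u v} → rank u ≡ rank v → u ≡ v
      ordered : ∀ {u v} → W u → W v → rank u < rank v → Q u v ≡ 2ℤ
      source : ∀ {v} → v ≢ p → rank p < rank v

  module _ {W : ℕ → Set} {Q : Quiver} {x p : ℕ} (launch : Launch W Q x p) where
    open Launch launch

    private
      T : ℕ → Set
      T v = v ≡ x ⊎ W v

      Q′ = μ p Q

      sk = isSkew

      x→p₊ : Arrow Q x p
      x→p₊ = 2≤⇒0< x→p

      p→ : ∀ {v} → W v → v ≢ p → Q p v ≡ 2ℤ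
      p→ Wv v≢p = ordered p∈W Wv (source v≢p)

      p→₊ : ∀ {v} → W v → v ≢ p → Arrow Q p v
      p→₊ Wv v≢p = subst (0ℤ ℤ.<_) (sym (p→ Wv v≢p)) 0<2

      x→ : ∀ {v} → W v → v ≢ p → Q′ x v ≡ Q x p * 2ℤ
      x→ {v} Wv v≢p = trans (μ-through {Q} sk x→p₊ (p→₊ Wv v≢p))
        (trans (cong₂ (λ a b → a + Q x p * b) (x-rest v Wv v≢p) (p→ Wv v≢p)) (ℤₚ.+-identityˡ _))

      double : ∀ {a} → 2ℤ ℤ.≤ a → 2ℤ ℤ.< a * 2ℤ × a ℤ.< a * 2ℤ
      double {a} 2≤a with product-dominates {a} {2ℤ} {0ℤ} 2≤a ℤₚ.≤-refl ℤ.-<+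
      ... | p , q rewrite ℤₚ.+-identityˡ (a * 2ℤ) = q , p

      inner : ∀ {u v} → W u → W v → u ≢ p → v ≢ p → Q′ u v ≡ Q u v
      inner Wu Wv u≢p v≢p = μ-valley {Q} sk (p→₊ Wu u≢p) (p→₊ Wv v≢p)

      arrow⇒rank : ∀ {u v} → W u → W v → Arrow Q u v → rank u < rank v
      arrow⇒rank {u} {v} Wu Wv uv with ℕₚ.<-cmp (rank u) (rank v)
      ... | tri< lt _ _ = lt
      ... | tri≈ _ eq _ = ⊥-elim (arrow-apart {Q} sk uv (rank-injective eq))
      ... | tri> _ _ gt = ⊥-elim (arrow-asym {Q} sk uv (subst (0ℤ ℤ.<_) (sym (ordered Wv Wu gt)) 0<2))

      compare : ∀ {u v} → W u → W v → u ≢ v → 2ℤ ℤ.≤ Q u v ⊎ 2ℤ ℤ.≤ Q v u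
      compare {u} {v} Wu Wv u≢v with ℕₚ.<-cmp (rank u) (rank v)
      ... | tri< lt _ _ = inj₁ (ℤₚ.≤-reflexive (sym (ordered Wu Wv lt)))
      ... | tri≈ _ eq _ = ⊥-elim (u≢v (rank-injective eq))
      ... | tri> _ _ gt = inj₂ (ℤₚ.≤-reflexive (sym (ordered Wv Wu gt)))

      inner-rank : ∀ {u v} → Arrow Q′ u v → u ≢ p → v ≢ p → W u → W v → rank u < rank v
      inner-rank uv u≢p v≢p Wu Wv = arrow⇒rank Wu Wv (subst (0ℤ ℤ.<_) (inner Wu Wv u≢p v≢p) uv)

      sk′ = μ-skew p {Q} sk

    launch-reaches : ∀ {v} → W v → v ≢ p → 2ℤ ℤ.≤ μ p Q x v
    launch-reaches Wv v≢p rewrite x→ Wv v≢p = ℤₚ.<⇒≤ (proj₁ (double x→p))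

    private
      abundant₀ : ∀ {u v} → T u → T v → u ≢ v → 2ℤ ℤ.≤ Q′ u v ⊎ 2ℤ ℤ.≤ Q′ v u
      abundant₀ (inj₁ refl) (inj₁ refl) u≢v = ⊥-elim (u≢v refl)
      abundant₀ {u} {v} (inj₁ refl) (inj₂ Wv) u≢v with classical (v ≡ p)
      ... | inj₁ refl = inj₂ (subst (2ℤ ℤ.≤_) (sym (μ-out {Q} sk v u)) x→p)
      ... | inj₂ v≢p = inj₁ (launch-reaches Wv v≢p)
      abundant₀ {u} {v} (inj₂ Wu) (inj₁ refl) u≢v with classical (u ≡ p)
      ... | inj₁ refl = inj₁ (subst (2ℤ ℤ.≤_) (sym (μ-out {Q} sk u v)) x→p)
      ... | inj₂ u≢p = inj₂ (launch-reaches Wu u≢p)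
      abundant₀ {u} {v} (inj₂ Wu) (inj₂ Wv) u≢v with classical (u ≡ p) | classical (v ≡ p)
      ... | inj₁ refl | _ = subst₂ (λ a b → 2ℤ ℤ.≤ a ⊎ 2ℤ ℤ.≤ b)
            (sym (μ-out {Q} sk p v)) (sym (μ-in {Q} sk p v)) (swap (compare Wu Wv u≢v))
      ... | inj₂ _ | inj₁ refl = subst₂ (λ a b → 2ℤ ℤ.≤ a ⊎ 2ℤ ℤ.≤ b)
            (sym (μ-in {Q} sk p u)) (sym (μ-out {Q} sk p u)) (swap (compare Wu Wv u≢v))
      ... | inj₂ u≢p | inj₂ v≢p rewrite inner Wu Wv u≢p v≢p | inner Wv Wu v≢p u≢p = compare Wu Wv u≢v

      x-source : ∀ {u} → T u → u ≢ p → ¬ Arrow Q′ u x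
      x-source (inj₁ refl) _ = arrow-irrefl {Q′} sk′
      x-source (inj₂ Wu) u≢p ux = arrow-asym {Q′} sk′ ux (2≤⇒0< (launch-reaches Wu u≢p))

      acyclic₀ : ∀ {u v w} → T u → T v → T w → u ≢ p → v ≢ p → w ≢ p →
        Arrow Q′ u v → Arrow Q′ v w → ¬ Arrow Q′ w u
      acyclic₀ (inj₁ refl) Tv Tw u≢p v≢p w≢p uv vw wu = x-source Tw w≢p wu
      acyclic₀ (inj₂ Wu) (inj₁ refl) Tw u≢p v≢p w≢p uv vw wu = x-source (inj₂ Wu) u≢p uv
      acyclic₀ (inj₂ _) (inj₂ Wv) (inj₁ refl) u≢p v≢p w≢p uv vw wu = x-source (inj₂ Wv) v≢p vw
      acyclic₀ (inj₂ Wu) (inj₂ Wv) (inj₂ Ww) u≢p v≢p w≢p uv vw wu = ℕₚ.<-irrefl refl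
        (ℕₚ.<-trans (inner-rank uv u≢p v≢p Wu Wv) (ℕₚ.<-trans (inner-rank vw v≢p w≢p Wv Ww) (inner-rank wu w≢p u≢p Ww Wu)))

      -- Before the mutation only `x` pointed at `p`, so now `p` points at `x` alone. The edges from
      -- `x` to the others have weight `Q x p * 2`, which exceeds both `Q x p` and 2.
      dominated₀ : ∀ {u v} → T u → T v → Arrow Q′ u p → Arrow Q′ p v →
        Q′ u p ℤ.< Q′ v u × Q′ p v ℤ.< Q′ v u
      dominated₀ {u} {v} Tu Tv up pv rewrite μ-in {Q} sk p u | μ-out {Q} sk p v with Tu | Tv
      ... | inj₁ refl | _ = ⊥-elim (arrow-asym {Q} sk x→p₊ up)
      ... | inj₂ Wu | inj₂ Wv = ⊥-elim (arrow-asym {Q} sk pv (p→₊ Wv (arrow-apart {Q} sk pv)))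
      ... | inj₂ Wu | inj₁ refl with arrow-apart {Q} sk up ∘ sym
      ...   | u≢p rewrite x→ Wu u≢p | p→ Wu u≢p = double x→p

    launch-fork : Fork T (μ p Q) p
    launch-fork = record
      { point = inj₂ p∈W ; abundant = abundant₀ ; acyclic = acyclic₀ ; dominated = dominated₀ }

    module _ (y : ℕ) (Wy : W y) (y≢p : y ≢ p) where

      -- The point of return is the letter mutated last, and neighbouring letters of a reduced stack
      -- differ, so no mutation hits it. Since `y` is never a letter, the arrow from `x` to `y`
      -- created at the launch persists.
      stack-fork : ∀ k st → All (λ v → W v × v ≢ y) (k ∷ st) → Linked _≢_ (k ∷ st) → bottom k st ≡ p →
        Fork T (μ* (k ∷ st) Q) k × 2ℤ ℤ.≤ μ* (k ∷ st) Q x y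
      stack-fork k [] _ _ refl = launch-fork , launch-reaches Wy y≢p
      stack-fork k (k′ ∷ st) ((Wk , k≢y) ∷ all@((Wk′ , k′≢y) ∷ _)) (k≢k′ ∷ red) bot
        with stack-fork k′ st all red bot
      ... | fork , reach =
        fork-μ sk* fork (inj₂ Wk) k≢k′ ,
        arrow-persists sk* fork (inj₂ Wk) k≢k′ (inj₁ refl) (inj₂ Wy)
          (x≢ Wk′) (k′≢y ∘ sym) (x≢ Wk) (k≢y ∘ sym) reach
        where
        sk* = μ*-skew (k′ ∷ st) {Q} sk
        x≢ : ∀ {v} → W v → x ≢ v
        x≢ Wv refl = x∉W Wv

  -- Words in the free product of copies of ℤ/2, as reduced stacks

  push : ℕ → List ℕ → List ℕ
  push a [] = a ∷ []
  push a (b ∷ st) with a ≟ b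
  ... | yes _ = st
  ... | no _ = a ∷ b ∷ st

  push-same : ∀ a st → push a (a ∷ st) ≡ st
  push-same a st with a ≟ a
  ... | yes _ = refl
  ... | no n = ⊥-elim (n refl)

  push-other : ∀ {a b} st → a ≢ b → push a (b ∷ st) ≡ a ∷ b ∷ st
  push-other {a} {b} st n with a ≟ b
  ... | yes e = ⊥-elim (n e)
  ... | no _ = refl

  push-reduced : ∀ a {st} → Linked _≢_ st → Linked _≢_ (push a st)
  push-reduced a [] = [-]
  push-reduced a ([-] {b}) with a ≟ b
  ... | yes _ = []
  ... | no n = n ∷ [-]
  push-reduced a (_∷_ {b} n red) with a ≟ b
  ... | yes _ = red
  ... | no n′ = n′ ∷ n ∷ red

  push-involutive : ∀ a {st} → Linked _≢_ st → push a (push a st) ≡ st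
  push-involutive a [] = push-same a []
  push-involutive a ([-] {b}) with a ≟ b
  ... | yes refl = refl
  ... | no _ = push-same a _
  push-involutive a (_∷_ {b} n red) with a ≟ b
  ... | yes refl = push-other _ n
  ... | no _ = push-same a _

  push-keeps : ∀ {a v} st → a ≢ v → v ∈ st → v ∈ push a st
  push-keeps {a} (b ∷ st) a≢v v∈ with a ≟ b
  push-keeps (b ∷ st) a≢v (here refl) | yes refl = ⊥-elim (a≢v refl)
  push-keeps (b ∷ st) a≢v (there v∈) | yes refl = v∈
  ... | no _ = there v∈

  push-all : ∀ {P : ℕ → Set} {a st} → P a → All P st → All P (push a st)
  push-all Pa [] = Pa ∷ []
  push-all {a = a} Pa (_∷_ {b} Pb all) with a ≟ b
  ... | yes _ = all
  ... | no _ = Pa ∷ Pb ∷ all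

  -- Reducedness is part of the state because `push a` is an involution on reduced stacks only;
  -- states are compared by their lists.
  stacks : InvolutiveAction
  stacks = record
    { Carrier = ∃[ st ] Linked _≢_ st
    ; _≈_ = λ x y → proj₁ x ≡ proj₁ y
    ; ≈-refl = refl
    ; ≈-sym = sym
    ; ≈-trans = trans
    ; act = λ a (st , red) → push a st , push-reduced a red
    ; act-cong = λ a → cong (push a)
    ; act-involutive = λ a (st , red) → push-involutive a red }

  empty : InvolutiveAction.Carrier stacks
  empty = [] , []

  -- Windows whose letters do not cancel

  below-bound : ∀ (f : ℕ → ℕ) n → ∃[ M ] (∀ t → t < n → f t < M)
  below-bound f zero = 0 , λ _ ()
  below-bound f (suc n) with below-bound f n
  ... | M , h = M ℕ.⊔ suc (f n) , λ t t<sn → case ℕₚ.m≤n⇒m<n∨m≡n (ℕₚ.≤-pred t<sn) of λ where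
    (inj₁ t<n) → ℕₚ.<-≤-trans (h t t<n) (ℕₚ.m≤m⊔n M (suc (f n)))
    (inj₂ refl) → ℕₚ.m≤n⊔m M (suc (f n))

  module Surviving (i : ℕ → ℕ) where

    Window : ℕ → ℕ → ℕ → Set
    Window N M t = N ≤ i t × i t < M

    windowStack : ℕ → ℕ → ℕ → InvolutiveAction.Carrier stacks
    windowStack N M t = run i stacks (Window N M) t empty

    windowStack-letters : ∀ N M t → All (λ v → N ≤ v × v < M) (proj₁ (windowStack N M t))
    windowStack-letters N M zero = []
    windowStack-letters N M (suc t) with em {Window N M t}
    ... | yes w = push-all w (windowStack-letters N M t)
    ... | no _ = windowStack-letters N M t

    module _ (B₀ : ℕ) (fin : ∀ v → B₀ ≤ v → ¬ InfOften i v)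
             (inf : ReductionInfinite i (NotSinfPos i)) (N : ℕ) (B₀≤N : B₀ ≤ N) where

      private
        K : ℕ → Set
        K = NotSinfPos i

        Red : ℕ → Set
        Red = ReducedPos i K

        P₀ : ℕ → Set
        P₀ t = N ≤ i t

        red-unbounded : Unbounded Red
        red-unbounded = ¬bounded⇒unbounded inf

        late : Eventually (λ m → ∀ v → v < N → K m → i m ≢ v)
        late = eventually-below {λ v m → K m → i m ≢ v} N (λ v _ → notSinf-finite i v)

        k₀ : ℕ
        k₀ = proj₁ (red-unbounded (proj₁ late))

        red-k₀ : Red k₀
        red-k₀ = proj₂ (proj₂ (red-unbounded (proj₁ late)))

        same-letters : ∀ t → k₀ ≤ t → (K t → P₀ t) × (P₀ t → K t)
        same-letters t k₀≤t =
          (λ Kt → ℕₚ.≮⇒≥ λ lt → proj₂ late t (ℕₚ.≤-trans (proj₁ (proj₂ (red-unbounded (proj₁ late)))) k₀≤t) (i t) lt Kt refl) ,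
          λ N≤it → fin (i t) (ℕₚ.≤-trans B₀≤N N≤it)

        -- Before `k₀` the runs along `K` and `P₀` may read different letters. Fitting the initial
        -- state backwards makes them agree from `k₀` on, and block reduction holds for any initial
        -- state.
        origin : ∃[ x ] proj₁ (run i stacks K k₀ x) ≡ proj₁ (run i stacks P₀ k₀ empty)
        origin = run-surjective i stacks {K} k₀ (run i stacks P₀ k₀ empty)

        x₀ : InvolutiveAction.Carrier stacks
        x₀ = proj₁ origin

        σ : ℕ → List ℕ
        σ t = proj₁ (run i stacks K t x₀)

        σ-letters : ∀ t → k₀ ≤ t → σ t ≡ proj₁ (run i stacks P₀ t empty)
        σ-letters t k₀≤t with ℕₚ.m≤n⇒m<n∨m≡n k₀≤t
        ... | inj₂ refl = proj₂ origin
        σ-letters (suc t) _ | inj₁ (s≤s k₀≤t) with σ-letters t k₀≤t | em {K t} | em {P₀ t}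
        ... | ih | yes _ | yes _ = cong (push (i t)) ih
        ... | ih | no _ | no _ = ih
        ... | ih | yes a | no b = ⊥-elim (b (proj₁ (same-letters t k₀≤t) a))
        ... | ih | no a | yes b = ⊥-elim (a (proj₂ (same-letters t k₀≤t) b))

        record Next (p : ℕ) : Set where
          field
            p′ : ℕ
            p<p′ : p < p′
            red′ : Red p′
            σ-push : σ p′ ≡ push (i p) (σ p)
            differ : i p ≢ i p′

        -- Take a stage with only reduced positions left below `q`. It is empty strictly between `p`
        -- and `q`, so only `i p` is pushed; and `q` starts a block of it, so its letter differs
        -- from that of its predecessor `p`.
        next : ∀ p → Red p → Next p
        next p red with red-unbounded (suc p)
        ... | q₀ , p<q₀ , red₀ with least {λ q → Red q × p < q} (red₀ , p<q₀)
        ...   | q , _ , (redq , p<q) , first with kseq-below i K (notSinf-finite i) q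
        ...     | m , early = record
          { p′ = q ; p<p′ = p<q ; red′ = redq
          ; σ-push = trans (by-stage q redq) (trans (cong proj₁
              (trans (run-skip i stacks {Kseq i K m} x₀ (suc p) q p<q (λ r p<r r<q → gap r p<r r<q))
                     (run-yes i stacks {Kseq i K m} x₀ (red m))))
              (cong (push (i p)) (sym (by-stage p red))))
          ; differ = proj₂ (proj₁ (redq (suc m))) p (red m , p<q , gap) }
          where
          gap : ∀ r → p < r → r < q → ¬ Kseq i K m r
          gap r p<r r<q Kr = first r r<q (early r r<q Kr , p<r)
          by-stage : ∀ t → Red t → σ t ≡ proj₁ (run i stacks (Kseq i K m) t x₀)
          by-stage t redt = run-kseq i stacks x₀ m
            λ j _ → blockStart⇒cut i (proj₁ (redt (suc j)))

        record Climbing (v p : ℕ) : Set where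
          field
            red : Red p
            k₀≤p : k₀ ≤ p
            top : ℕ
            rest : List ℕ
            shape : σ p ≡ top ∷ rest
            top≢ : top ≢ i p
            v∈ : v ∈ top ∷ rest

        -- The stack cannot shrink at every reduced position; once a push does not cancel,
        -- no later one does, since consecutive reduced letters differ.
        first-climb : ∀ n p → Red p → k₀ ≤ p → length (σ p) ≤ n →
          ∃[ v ] (¬ InfOften i v × ∃[ q ] Climbing v q)
        first-climb n p redp k₀≤p len = go n (σ p) refl len
          where
          open Next (next p redp)
          climbed : σ p′ ≡ i p ∷ σ p → ∃[ v ] (¬ InfOften i v × ∃[ q ] Climbing v q)
          climbed e = i p , redp 0 , p′ , record
            { red = red′ ; k₀≤p = ℕₚ.≤-trans k₀≤p (ℕₚ.<⇒≤ p<p′)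
            ; top = i p ; rest = σ p ; shape = e ; top≢ = differ ; v∈ = here refl }
          go : ∀ n st → σ p ≡ st → length (σ p) ≤ n → ∃[ v ] (¬ InfOften i v × ∃[ q ] Climbing v q)
          go n [] e _ = climbed (trans σ-push (trans (cong (push (i p)) e) (cong (i p ∷_) (sym e))))
          go zero (b ∷ st) e le = ⊥-elim (ℕₚ.n≮0 (subst (λ l → length l ≤ 0) e le))
          go (suc n) (b ∷ st) e le with classical (i p ≡ b)
          ... | inj₂ ne = climbed (trans σ-push (trans (cong (push (i p)) e)
                            (trans (push-other st ne) (cong (i p ∷_) (sym e)))))
          ... | inj₁ refl = first-climb n p′ red′ (ℕₚ.≤-trans k₀≤p (ℕₚ.<⇒≤ p<p′))
              (subst (λ l → length l ≤ n) (sym (trans σ-push (trans (cong (push (i p)) e) (push-same b st))))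
                     (ℕₚ.≤-pred (subst (λ l → length l ≤ suc n) e le)))

        climb-on : ∀ {v p} → Climbing v p → ∀ n → ∃[ q ] (n ≤ q × Climbing v q)
        climb-on {p = p} c zero = p , z≤n , c
        climb-on c (suc n) with climb-on c n
        ... | q , n≤q , c′ = p′ , ℕₚ.≤-<-trans n≤q p<p′ , record
          { red = red′ ; k₀≤p = ℕₚ.≤-trans k₀≤p (ℕₚ.<⇒≤ p<p′)
          ; top = i q ; rest = top ∷ rest
          ; shape = trans σ-push (trans (cong (push (i q)) shape) (push-other rest (top≢ ∘ sym)))
          ; top≢ = differ ; v∈ = there v∈ }
          where
          open Climbing c′
          open Next (next q red)

      -- Only `v` itself can cancel `v`. Wait until `v` is on the stack and no longer occurs in `i`,
      -- then choose `M` above all letters read so far: nothing is lost up to that time, and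
      -- whichever letters follow, `v` stays.
      surviving-window : ∃[ M ] Eventually (λ t → ¬ Window N M t × proj₁ (windowStack N M t) ≢ [])
      surviving-window with first-climb _ k₀ red-k₀ ℕₚ.≤-refl ℕₚ.≤-refl
      ... | v , ¬inf , p , c with finOften⇒eventually≢ ¬inf
      ...   | Tv , away with climb-on c Tv
      ...     | q , Tv≤q , c′ with below-bound i q
      ...       | M , small with eventually-below {λ v m → N ≤ v → i m ≢ v} M
                    (λ v _ → quiet v)
                    where
                    quiet : ∀ v → Eventually (λ m → N ≤ v → i m ≢ v)
                    quiet v with classical (N ≤ v)
                    ... | inj₁ N≤v = let T , h = finOften⇒eventually≢ (fin v (ℕₚ.≤-trans B₀≤N N≤v)) in T , λ m le _ → h m le
                    ... | inj₂ N≰v = 0 , λ _ _ N≤v → ⊥-elim (N≰v N≤v)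
      ...         | T , silent = M , T ℕ.⊔ q , λ t le →
          (λ (N≤it , it<M) → silent t (ℕₚ.≤-trans (ℕₚ.m≤m⊔n T q) le) (i t) it<M N≤it refl) ,
          λ e → nonempty (subst (v ∈_) e (subst (λ k → v ∈ proj₁ (windowStack N M k))
                   (ℕₚ.m+[n∸m]≡n (ℕₚ.≤-trans (ℕₚ.m≤n⊔m T q) le)) (stays (t ℕ.∸ q))))
        where
        open Climbing c′
        nonempty : ¬ (v ∈ [])
        nonempty ()
        at-q : proj₁ (windowStack N M q) ≡ top ∷ rest
        at-q = trans (run-cong i stacks {Window N M} {P₀} empty empty q refl λ r r<q → proj₁ , λ N≤ → N≤ , small r r<q)
                     (trans (sym (σ-letters q k₀≤p)) shape)
        stays : ∀ n → v ∈ proj₁ (windowStack N M (q ℕ.+ n))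
        stays zero rewrite ℕₚ.+-identityʳ q = subst (v ∈_) (sym at-q) v∈
        stays (suc n) rewrite ℕₚ.+-suc q n with em {Window N M (q ℕ.+ n)}
        ... | yes _ = push-keeps (proj₁ (windowStack N M (q ℕ.+ n))) (away _ (ℕₚ.≤-trans Tv≤q (ℕₚ.m≤m+n q n))) (stays n)
        ... | no _ = stays n

  -- Divergence

  bottom-all : ∀ {P : ℕ → Set} {k} st → All P (k ∷ st) → P (bottom k st)
  bottom-all [] (Pk ∷ []) = Pk
  bottom-all (k′ ∷ st) (_ ∷ all) = bottom-all st all

  μ*-push : ∀ k st H → μ k (μ* st H) ≐ μ* (push k st) H
  μ*-push k [] H v w = refl
  μ*-push k (k′ ∷ st) H with classical (k ≡ k′)
  ... | inj₁ refl rewrite push-same k st = μ-involutive k (μ* st H)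
  ... | inj₂ k≢k′ rewrite push-other st k≢k′ = λ _ _ → refl

  dependentChoice : {A : Set} {R : A → A → Set} → (∀ a → ∃[ a′ ] R a a′) → ∀ a →
    ∃[ f ] (f 0 ≡ a × (∀ n → R (f n) (f (suc n))))
  dependentChoice {A} next a = f , refl , λ n → proj₂ (next (f n))
    where
    f : ℕ → A
    f zero = a
    f (suc n) = proj₁ (next (f n))

  -- Pairwise disjoint windows [lo r , hi r) of vertices, whose letters in i leave a nonempty
  -- stack and occur only between the times stop (r - 1) and stop r.
  record BlockChain (i : ℕ → ℕ) : Set where
    open Surviving i
    field
      lo hi port stop : ℕ → ℕ
      singleton : hi 0 ≡ suc (lo 0)
      lo≤port : ∀ r → lo r ≤ port r
      port<hi : ∀ r → port r < hi r
      hi≤lo-suc : ∀ r → hi r ≤ lo (suc r)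
      quiet : ∀ r m → stop r ≤ m → ¬ (lo r ≤ i m × i m < hi r)
      early : ∀ r m → m < stop r → i m < lo (suc r)
      stop<stop : ∀ r → stop r < stop (suc r)
      top : ℕ → ℕ
      rest : ℕ → List ℕ
      stack : ∀ r → proj₁ (windowStack (lo (suc r)) (hi (suc r)) (stop (suc r))) ≡ top r ∷ rest r
      port-bottom : ∀ r → bottom (top r) (rest r) ≡ port (suc r)

  -- Construction of the chain of windows

  module _ (i : ℕ → ℕ) (B₀ : ℕ) (fin : ∀ v → B₀ ≤ v → ¬ InfOften i v)
           (inf : ReductionInfinite i (NotSinfPos i))
           (b : ℕ) (B₀≤b : B₀ ≤ b) where
    open Surviving i

    private
      record Block : Set where
        field
          lo hi port stop : ℕ
          b≤lo : b ≤ lo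
          lo≤port : lo ≤ port
          port<hi : port < hi
          quiet : ∀ m → stop ≤ m → ¬ (lo ≤ i m × i m < hi)

      record Follows (B B′ : Block) : Set where
        private
          module B = Block B
          module B′ = Block B′
        field
          hi≤lo : B.hi ≤ B′.lo
          early : ∀ m → m < B.stop → i m < B′.lo
          stop<stop : B.stop < B′.stop
          top : ℕ
          rest : List ℕ
          stack : proj₁ (windowStack B′.lo B′.hi B′.stop) ≡ top ∷ rest
          port-bottom : bottom top rest ≡ B′.port

      next-block : (B : Block) → ∃[ B′ ] Follows B B′
      next-block B = build (surviving-window B₀ fin inf N (ℕₚ.≤-trans B₀≤b b≤N))
        where
        open Block B
        bounded : ∃[ M ] (∀ t → t < stop → i t < M)
        bounded = below-bound i stop
        -- Above the previous block, and above every letter read before its `stop`, so that no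
        -- vertex of the new block is mutated before that time.
        N : ℕ
        N = hi ℕ.⊔ proj₁ bounded
        hi≤N : hi ≤ N
        hi≤N = ℕₚ.m≤m⊔n hi (proj₁ bounded)
        b≤N : b ≤ N
        b≤N = ℕₚ.≤-trans (ℕₚ.≤-trans b≤lo lo≤port) (ℕₚ.≤-trans (ℕₚ.<⇒≤ port<hi) hi≤N)
        build : ∃[ M ] Eventually (λ t → ¬ Window N M t × proj₁ (windowStack N M t) ≢ []) → ∃[ B′ ] Follows B B′
        build (M , T , h) = finish-with (proj₁ (windowStack N M stop′)) refl
          where
          stop′ : ℕ
          stop′ = T ℕ.⊔ suc stop
          finish-with : ∀ st → proj₁ (windowStack N M stop′) ≡ st → ∃[ B′ ] Follows B B′
          finish-with [] e = ⊥-elim (proj₂ (h stop′ (ℕₚ.m≤m⊔n T (suc stop))) e)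
          finish-with (k ∷ st) e =
            record { lo = N ; hi = M ; port = bottom k st ; stop = stop′ ; b≤lo = b≤N
                   ; lo≤port = proj₁ in-window ; port<hi = proj₂ in-window
                   ; quiet = λ m le → proj₁ (h m (ℕₚ.≤-trans (ℕₚ.m≤m⊔n T (suc stop)) le)) } ,
            record { hi≤lo = hi≤N
                   ; early = λ m lt → ℕₚ.<-≤-trans (proj₂ bounded m lt) (ℕₚ.m≤n⊔m hi (proj₁ bounded))
                   ; stop<stop = ℕₚ.m≤n⊔m T (suc stop)
                   ; top = k ; rest = st ; stack = e ; port-bottom = refl }
            where
            in-window : N ≤ bottom k st × bottom k st < M
            in-window = bottom-all st (subst (All (λ v → N ≤ v × v < M)) e (windowStack-letters N M stop′))

      silent-b : Eventually (λ m → i m ≢ b)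
      silent-b = finOften⇒eventually≢ (fin b B₀≤b)

      -- The vertex `b`, whose row will not settle, is a block by itself, with a `stop` after which
      -- it is never mutated.
      first-block : Block
      first-block = record
        { lo = b ; hi = suc b ; port = b ; stop = proj₁ silent-b ; b≤lo = ℕₚ.≤-refl
        ; lo≤port = ℕₚ.≤-refl ; port<hi = ℕₚ.≤-refl
        ; quiet = λ m le (b≤ , <sb) → proj₂ silent-b m le (ℕₚ.≤-antisym (ℕₚ.≤-pred <sb) b≤) }

    blockChain : ∃[ C ] BlockChain.lo {i} C 0 ≡ b
    blockChain = assemble (dependentChoice {R = Follows} next-block first-block)
      where
      assemble : ∃[ chain ] (chain 0 ≡ first-block × (∀ r → Follows (chain r) (chain (suc r)))) →
        ∃[ C ] BlockChain.lo {i} C 0 ≡ b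
      assemble (chain , e , follows) = record
        { lo = λ r → Block.lo (chain r) ; hi = λ r → Block.hi (chain r)
        ; port = λ r → Block.port (chain r) ; stop = λ r → Block.stop (chain r)
        ; singleton = trans (cong Block.hi e) (sym (cong (λ B → suc (Block.lo B)) e))
        ; lo≤port = λ r → Block.lo≤port (chain r)
        ; port<hi = λ r → Block.port<hi (chain r)
        ; hi≤lo-suc = λ r → Follows.hi≤lo (follows r)
        ; quiet = λ r → Block.quiet (chain r)
        ; early = λ r → Follows.early (follows r)
        ; stop<stop = λ r → Follows.stop<stop (follows r)
        ; top = λ r → Follows.top (follows r)
        ; rest = λ r → Follows.rest (follows r)
        ; stack = λ r → Follows.stack (follows r)
        ; port-bottom = λ r → Follows.port-bottom (follows r) } , cong Block.lo e

  -- The divergent quiver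

  module Divergence (i : ℕ → ℕ) (C : BlockChain i) (Q : LFQuiver)
                    (outer : ∀ v → BlockChain.lo C 0 ≤ v → Isolated (quiver Q) v) where
    open Surviving i
    open BlockChain C

    hi≤lo : ∀ {r r′} → r < r′ → hi r ≤ lo r′
    hi≤lo {r} {suc r′} (s≤s r≤r′) with ℕₚ.m≤n⇒m<n∨m≡n r≤r′
    ... | inj₂ refl = hi≤lo-suc r
    ... | inj₁ r<r′ = ℕₚ.≤-trans (hi≤lo r<r′) (ℕₚ.≤-trans (lo≤port r′)
                        (ℕₚ.≤-trans (ℕₚ.<⇒≤ (port<hi r′)) (hi≤lo-suc r′)))

    lo<hi : ∀ r → lo r < hi r
    lo<hi r = ℕₚ.≤-<-trans (lo≤port r) (port<hi r)

    lo-mono : ∀ {r r′} → r ≤ r′ → lo r ≤ lo r′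
    lo-mono {r} r≤r′ with ℕₚ.m≤n⇒m<n∨m≡n r≤r′
    ... | inj₂ refl = ℕₚ.≤-refl
    ... | inj₁ r<r′ = ℕₚ.≤-trans (ℕₚ.<⇒≤ (lo<hi r)) (hi≤lo r<r′)

    lo-expands : ∀ r → r ≤ lo r
    lo-expands zero = z≤n
    lo-expands (suc r) = ℕₚ.≤-<-trans (lo-expands r) (ℕₚ.<-≤-trans (lo<hi r) (hi≤lo (ℕₚ.n<1+n r)))

    stop-mono : ∀ {r r′} → r ≤ r′ → stop r ≤ stop r′
    stop-mono {r} {r′} r≤r′ with ℕₚ.m≤n⇒m<n∨m≡n r≤r′
    ... | inj₂ refl = ℕₚ.≤-refl
    stop-mono {r} {suc r′} _ | inj₁ (s≤s r≤r′) =
      ℕₚ.≤-trans (stop-mono r≤r′) (ℕₚ.<⇒≤ (stop<stop r′))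

    stop-expands : ∀ r → r ≤ stop r
    stop-expands zero = z≤n
    stop-expands (suc r) = ℕₚ.≤-<-trans (stop-expands r) (stop<stop r)

    x p₁ : ℕ
    x = port 0
    p₁ = port 1

    InBlockOf : ℕ → ℕ → Set
    InBlockOf r u = lo r ≤ u × u < hi r

    Mem : ℕ → ℕ → Set
    Mem r u = InBlockOf r u ⊎ u ≡ port (suc r)

    Adj : ℕ → ℕ → ℕ → Set
    Adj r u v = Mem r u × Mem r v

    port-block : ∀ r → InBlockOf r (port r)
    port-block r = lo≤port r , port<hi r

    mem⇒lo≤ : ∀ r {u} → Mem r u → lo r ≤ u
    mem⇒lo≤ r (inj₁ (a , _)) = a
    mem⇒lo≤ r (inj₂ refl) = ℕₚ.≤-trans (lo-mono (ℕₚ.n≤1+n r)) (lo≤port (suc r))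

    mem⇒<hi : ∀ r {u} → Mem r u → u < hi (suc r)
    mem⇒<hi r (inj₁ (_ , c)) = ℕₚ.<-trans c (ℕₚ.≤-<-trans (hi≤lo (ℕₚ.n<1+n r)) (lo<hi (suc r)))
    mem⇒<hi r (inj₂ refl) = port<hi (suc r)

    mem-late : ∀ r {u} → Mem r u → lo (suc r) ≤ u → u ≡ port (suc r)
    mem-late r (inj₁ (_ , c)) le = ⊥-elim (ℕₚ.<⇒≱ c (ℕₚ.≤-trans (hi≤lo (ℕₚ.n<1+n r)) le))
    mem-late r (inj₂ e) _ = e

    -- Different tournaments have at most a port in common, so two distinct vertices determine the
    -- tournament that joins them and `G` is well defined.
    mem-overlap : ∀ {r r′ u v} → r < r′ → Adj r u v → Adj r′ u v → u ≡ v
    mem-overlap {r} {r′} lt (mu , mv) (mu′ , mv′) =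
      trans (mem-late r mu (ℕₚ.≤-trans (lo-mono lt) (mem⇒lo≤ r′ mu′)))
            (sym (mem-late r mv (ℕₚ.≤-trans (lo-mono lt) (mem⇒lo≤ r′ mv′))))

    adj-unique : ∀ {r r′ u v} → u ≢ v → Adj r u v → Adj r′ u v → r ≡ r′
    adj-unique {r} {r′} u≢v a a′ with ℕₚ.<-cmp r r′
    ... | tri< lt _ _ = ⊥-elim (u≢v (mem-overlap lt a a′))
    ... | tri≈ _ e _ = e
    ... | tri> _ _ gt = ⊥-elim (u≢v (mem-overlap gt a′ a))

    -- The natural order with the port moved to the front, where it becomes the source.
    rank : ℕ → ℕ → ℕ
    rank r v with v ≟ port r
    ... | yes _ = 0
    ... | no _ = suc v

    rank-injective : ∀ r {u v} → rank r u ≡ rank r v → u ≡ v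
    rank-injective r {u} {v} e with u ≟ port r | v ≟ port r
    ... | yes a | yes c = trans a (sym c)
    ... | no _ | no _ = ℕₚ.suc-injective e

    rank-source : ∀ r {v} → v ≢ port r → rank r (port r) < rank r v
    rank-source r {v} v≢p with port r ≟ port r | v ≟ port r
    ... | no n | _ = ⊥-elim (n refl)
    ... | yes _ | yes e = ⊥-elim (v≢p e)
    ... | yes _ | no _ = s≤s z≤n

    sg : ℕ → ℤ
    sg zero = 1ℤ
    sg (suc t) with i t ≟ x
    ... | yes _ = - sg t
    ... | no _ = sg t

    sg-flip : ∀ t → i t ≡ x → sg (suc t) ≡ - sg t
    sg-flip t e with i t ≟ x
    ... | yes _ = refl
    ... | no n = ⊥-elim (n e)

    sg-keep : ∀ t → i t ≢ x → sg (suc t) ≡ sg t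
    sg-keep t n with i t ≟ x
    ... | yes e = ⊥-elim (n e)
    ... | no _ = refl

    sg-square : ∀ t → sg t * sg t ≡ 1ℤ
    sg-square zero = refl
    sg-square (suc t) with i t ≟ x
    ... | yes _ = trans (sym (ℤₚ.neg-distribˡ-* (sg t) (- sg t)))
                    (trans (cong -_ (sym (ℤₚ.neg-distribʳ-* (sg t) (sg t))))
                      (trans (ℤₚ.neg-involutive _) (sg-square t)))
    ... | no _ = sg-square t

    -- Every mutation at x flips the edge at x, and all of them happen before stop 0; this sign
    -- makes that edge a double arrow out of x at that time.
    weight : ℕ → ℤ
    weight zero = 2ℤ * sg (stop 0)
    weight (suc r) = 2ℤ

    oriented : ℕ → ℕ → ℕ → ℤ
    oriented r u v with ℕₚ.<-cmp (rank r u) (rank r v)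
    ... | tri< _ _ _ = weight r
    ... | tri≈ _ _ _ = 0ℤ
    ... | tri> _ _ _ = - weight r

    oriented-< : ∀ r {u v} → rank r u < rank r v → oriented r u v ≡ weight r
    oriented-< r {u} {v} lt with ℕₚ.<-cmp (rank r u) (rank r v)
    ... | tri< _ _ _ = refl
    ... | tri≈ n _ _ = ⊥-elim (n lt)
    ... | tri> n _ _ = ⊥-elim (n lt)

    oriented-skew : ∀ r u v → oriented r u v ≡ - oriented r v u
    oriented-skew r u v with ℕₚ.<-cmp (rank r u) (rank r v) | ℕₚ.<-cmp (rank r v) (rank r u)
    ... | tri< _ _ _ | tri> _ _ _ = sym (ℤₚ.neg-involutive (weight r))
    ... | tri≈ _ _ _ | tri≈ _ _ _ = refl
    ... | tri> _ _ _ | tri< _ _ _ = refl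
    ... | tri< a _ _ | tri< _ _ n = ⊥-elim (n a)
    ... | tri< a _ _ | tri≈ _ _ n = ⊥-elim (n a)
    ... | tri≈ _ _ n | tri< a _ _ = ⊥-elim (n a)
    ... | tri≈ n _ _ | tri> _ _ a = ⊥-elim (n a)
    ... | tri> _ _ a | tri≈ n _ _ = ⊥-elim (n a)
    ... | tri> _ _ a | tri> n _ _ = ⊥-elim (n a)

    oriented-diag : ∀ r u → oriented r u u ≡ 0ℤ
    oriented-diag r u = i≡-i⇒i≡0 (oriented-skew r u u)

    G : Quiver
    G u v with classical (∃[ r ] Adj r u v)
    ... | inj₁ (r , _) = oriented r u v
    ... | inj₂ _ = 0ℤ

    G-adjacent : ∀ {r u v} → Adj r u v → G u v ≡ oriented r u v
    G-adjacent {r} {u} {v} a with classical (∃[ r ] Adj r u v)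
    ... | inj₂ none = ⊥-elim (none (r , a))
    ... | inj₁ (r′ , a′) with classical (u ≡ v)
    ...   | inj₁ refl = trans (oriented-diag r′ u) (sym (oriented-diag r u))
    ...   | inj₂ u≢v = cong (λ k → oriented k u v) (adj-unique u≢v a′ a)

    G-zero : ∀ {u v} → (∀ r → ¬ Adj r u v) → G u v ≡ 0ℤ
    G-zero {u} {v} none with classical (∃[ r ] Adj r u v)
    ... | inj₁ (r , a) = ⊥-elim (none r a)
    ... | inj₂ _ = refl

    G-skew : IsSkew G
    G-skew u v with classical (∃[ r ] Adj r v u)
    ... | inj₁ (r , mv , mu) = trans (G-adjacent (mu , mv)) (oriented-skew r u v)
    ... | inj₂ none = G-zero λ r (mu , mv) → none (r , mv , mu)

    G-finiteRows : FiniteRows G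
    G-finiteRows u = hi (suc u) , λ v le → G-zero λ r (mu , mv) →
      ℕₚ.<⇒≱ (mem⇒<hi r mv) (ℕₚ.≤-trans (hi-mono (s≤s (ℕₚ.≤-trans (lo-expands r) (mem⇒lo≤ r mu)))) le)
      where
      hi-mono : ∀ {r r′} → r ≤ r′ → hi r ≤ hi r′
      hi-mono {r} {r′} le with ℕₚ.m≤n⇒m<n∨m≡n le
      ... | inj₂ refl = ℕₚ.≤-refl
      ... | inj₁ lt = ℕₚ.≤-trans (hi≤lo lt) (ℕₚ.<⇒≤ (lo<hi r′))

    Q′ : LFQuiver
    Q′ = Q ⊕ mkLF G G-skew (finiteRows⇒locFin G-finiteRows)

    Q′-inner : ∀ u → u < lo 0 → ∀ v → quiver Q′ u v ≡ quiver Q u v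
    Q′-inner u u<b v = trans (cong (λ z → quiver Q u v + z)
      (G-zero λ r (mu , _) → ℕₚ.<⇒≱ u<b (ℕₚ.≤-trans (lo-mono {0} {r} z≤n) (mem⇒lo≤ r mu)))) (ℤₚ.+-identityʳ _)

    Q′-outer : ∀ {u} → lo 0 ≤ u → ∀ v → quiver Q′ u v ≡ G u v
    Q′-outer {u} b≤u v = trans (cong (λ z → z + G u v) (outer u b≤u v)) (ℤₚ.+-identityˡ _)

    q : ℕ → Quiver
    q = iterMut i (quiver Q′)

    q-skew : ∀ t → IsSkew (q t)
    q-skew = iterMut-skew i (skew Q′)

    flip-zero : ∀ t {u v} → q t u v ≡ 0ℤ → q t v u ≡ 0ℤ
    flip-zero t = skew-zero {q t} (q-skew t)

    Live : ℕ → Set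
    Live u = ∃[ r ] InBlockOf r u

    mem⇒live : ∀ {r u} → Mem r u → Live u
    mem⇒live {r} (inj₁ h) = r , h
    mem⇒live {r} (inj₂ refl) = suc r , port-block (suc r)

    live⇒b≤ : ∀ {u} → Live u → lo 0 ≤ u
    live⇒b≤ (r , lo≤u , _) = ℕₚ.≤-trans (lo-mono {0} {r} z≤n) lo≤u

    -- The blocks start with no arrows to the other vertices, and mutation creates arrows only along
    -- paths of existing ones.
    live-closed : ∀ t {u z} → Live u → ¬ Live z → q t u z ≡ 0ℤ
    live-closed zero {u} {z} Lu ¬Lz = trans (Q′-outer (live⇒b≤ Lu) z) (G-zero λ r (_ , mz) → ¬Lz (mem⇒live {r} mz))
    live-closed (suc t) {u} {z} Lu ¬Lz = μ-zero (i t) (q t) u z (live-closed t Lu ¬Lz) (at (classical (Live (i t))))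
      where
      at : Live (i t) ⊎ ¬ Live (i t) → q t u (i t) ≡ 0ℤ ⊎ q t (i t) z ≡ 0ℤ
      at (inj₁ L) = inj₂ (live-closed t L ¬Lz)
      at (inj₂ ¬L) = inj₁ (live-closed t Lu ¬L)

    -- Before stop r only vertices below lo (suc r) are mutated, and the later blocks
    -- are attached to those only through port (suc r).
    untouched : ∀ r t → t ≤ stop r →
      (∀ u v → lo (suc r) ≤ u → lo (suc r) ≤ v → q t u v ≡ G u v) ×
      (∀ u w → lo (suc r) ≤ u → u ≢ port (suc r) → w < lo (suc r) → q t u w ≡ 0ℤ)
    untouched r zero _ =
      (λ u v le _ → Q′-outer (ℕₚ.≤-trans (lo-mono {0} {suc r} z≤n) le) v) ,
      λ u w le u≢p lt → trans (Q′-outer (ℕₚ.≤-trans (lo-mono {0} {suc r} z≤n) le) w)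
        (G-zero λ r′ (mu , mw) → u≢p (attach r′ mu mw le lt))
      where
      attach : ∀ r′ {u w} → Mem r′ u → Mem r′ w → lo (suc r) ≤ u → w < lo (suc r) → u ≡ port (suc r)
      attach r′ mu mw le lt with ℕₚ.<-cmp r r′
      ... | tri< r<r′ _ _ = ⊥-elim (ℕₚ.<⇒≱ lt (ℕₚ.≤-trans (lo-mono r<r′) (mem⇒lo≤ r′ mw)))
      ... | tri≈ _ refl _ = mem-late r mu le
      ... | tri> _ _ r′<r = ⊥-elim (ℕₚ.<⇒≱ (mem⇒<hi r′ mu) (ℕₚ.≤-trans (hi≤lo (s≤s r′<r)) le))
    untouched r (suc t) t<stop with untouched r t (ℕₚ.<⇒≤ t<stop) | early r t t<stop
    ... | same , away | z<lo = same′ ,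
        λ u w le u≢p lt → μ-zero (i t) (q t) u w (away u w le u≢p lt) (inj₁ (away u (i t) le u≢p z<lo))
      where
      apart : ∀ {u} → lo (suc r) ≤ u → i t ≢ u
      apart le refl = ℕₚ.<⇒≱ z<lo le
      same′ : ∀ u v → lo (suc r) ≤ u → lo (suc r) ≤ v → μ (i t) (q t) u v ≡ G u v
      same′ u v leu lev with classical (u ≡ port (suc r)) | classical (v ≡ port (suc r))
      -- A vertex other than the port has no arrow to `i t`, so a path through `i t` would need both
      -- ends at the port; there skew-symmetry forces zero.
      ... | inj₁ refl | inj₁ refl = trans (skew-diag (q-skew (suc t)) (port (suc r))) (sym (skew-diag G-skew (port (suc r))))
      ... | inj₂ u≢p | _ = trans (μ-no-path (i t) (q t) u v (apart leu) (apart lev) (inj₁ (away u (i t) leu u≢p z<lo))) (same u v leu lev)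
      ... | inj₁ _ | inj₂ v≢p = trans (μ-no-path (i t) (q t) u v (apart leu) (apart lev)
              (inj₂ (flip-zero t (away v (i t) lev v≢p z<lo)))) (same u v leu lev)

    x<lo : ∀ r → x < lo (suc r)
    x<lo r = ℕₚ.<-≤-trans (port<hi 0) (hi≤lo {0} (s≤s z≤n))

    only-x : ∀ {u} → InBlockOf 0 u → u ≡ x
    only-x (le , lt) = trans (ℕₚ.≤-antisym (ℕₚ.≤-pred (ℕₚ.≤-trans lt (ℕₚ.≤-reflexive singleton))) le)
      (ℕₚ.≤-antisym (lo≤port 0) (ℕₚ.≤-pred (ℕₚ.≤-trans (port<hi 0) (ℕₚ.≤-reflexive singleton))))

    -- All vertices mutated up to `stop 0` lie below `lo 1`. Among them `x` is the only possible
    -- neighbour of `p₁`, and `p₁` is the only neighbour of `x`; hence their edge changes by signs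
    -- alone.
    starting : ∀ t → t ≤ stop 0 →
      q t x p₁ ≡ weight 0 * sg t ×
      (∀ w → w ≢ p₁ → q t x w ≡ 0ℤ) ×
      (∀ w → w < lo 1 → w ≢ x → q t w p₁ ≡ 0ℤ)
    starting zero _ =
      trans (Q′-outer (lo≤port 0) p₁)
        (trans (G-adjacent {0} (inj₁ (port-block 0) , inj₂ refl))
          (trans (oriented-< 0 (rank-source 0 λ p₁≡x → ℕₚ.<⇒≢ (ℕₚ.<-≤-trans (x<lo 0) (lo≤port 1)) (sym p₁≡x)))
                 (sym (ℤₚ.*-identityʳ _)))) ,
      (λ w w≢p₁ → row w w≢p₁ (classical (w ≡ x))) ,
      λ w w<lo w≢x → trans (skew Q′ w p₁) (cong -_ (trans (Q′-outer (ℕₚ.≤-trans (lo-mono {0} {1} z≤n) (lo≤port 1)) w)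
        (G-zero λ r (mp , mw) → w≢x (only r mw w<lo))))
      where
      only : ∀ r {w} → Mem r w → w < lo 1 → w ≡ x
      only zero (inj₁ h) _ = only-x h
      only zero (inj₂ refl) lt = ⊥-elim (ℕₚ.<⇒≱ lt (lo≤port 1))
      only (suc r) m lt = ⊥-elim (ℕₚ.<⇒≱ lt (ℕₚ.≤-trans (lo-mono {1} {suc r} (s≤s z≤n)) (mem⇒lo≤ (suc r) m)))
      row : ∀ w → w ≢ p₁ → w ≡ x ⊎ w ≢ x → quiver Q′ x w ≡ 0ℤ
      row w _ (inj₁ refl) = skew-diag (skew Q′) x
      row w w≢p₁ (inj₂ w≢x) = trans (Q′-outer (lo≤port 0) w) (G-zero λ where
        zero (_ , inj₁ h) → w≢x (only-x h)
        zero (_ , inj₂ e) → w≢p₁ e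
        (suc r) (mx , _) → ℕₚ.<⇒≱ (x<lo r) (mem⇒lo≤ (suc r) mx))
    starting (suc t) t<stop with starting t (ℕₚ.<⇒≤ t<stop) | early 0 t t<stop
    ... | edge , row , column | z<lo =
        edge′ , (λ w w≢p₁ → μ-zero (i t) (q t) x w (row w w≢p₁) (row′ w w≢p₁)) ,
        λ w w<lo w≢x → μ-zero (i t) (q t) w p₁ (column w w<lo w≢x) (column′ w w<lo w≢x)
      where
      below-p₁ : ∀ {w} → w < lo 1 → w ≢ p₁
      below-p₁ w<lo refl = ℕₚ.<⇒≱ w<lo (lo≤port 1)
      row′ : ∀ w → w ≢ p₁ → q t x (i t) ≡ 0ℤ ⊎ q t (i t) w ≡ 0ℤ
      row′ w w≢p₁ = inj₁ (row (i t) (below-p₁ z<lo))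
      column′ : ∀ w → w < lo 1 → w ≢ x → q t w (i t) ≡ 0ℤ ⊎ q t (i t) p₁ ≡ 0ℤ
      column′ w w<lo w≢x with classical (i t ≡ x)
      ... | inj₁ z≡x = inj₁ (subst (λ z → q t w z ≡ 0ℤ) (sym z≡x) (flip-zero t (row w (below-p₁ w<lo))))
      ... | inj₂ z≢x = inj₂ (column (i t) z<lo z≢x)
      edge′ : μ (i t) (q t) x p₁ ≡ weight 0 * sg (suc t)
      edge′ with classical (i t ≡ x)
      ... | inj₁ z≡x = trans (μ-incident (i t) (q t) x p₁ (inj₁ z≡x))
        (trans (cong -_ edge) (trans (ℤₚ.neg-distribʳ-* (weight 0) (sg t)) (cong (λ s → weight 0 * s) (sym (sg-flip t z≡x)))))
      ... | inj₂ z≢x = trans (μ-no-path (i t) (q t) x p₁ z≢x (below-p₁ z<lo) (inj₁ (row (i t) (below-p₁ z<lo))))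
        (trans edge (cong (λ s → weight 0 * s) (sym (sg-keep t z≢x))))

    ready-0 : 2ℤ ℤ.≤ q (stop 0) x p₁
    ready-0 = ℤₚ.≤-reflexive (sym (trans (proj₁ (starting (stop 0) ℕₚ.≤-refl))
      (trans (ℤₚ.*-assoc 2ℤ (sg (stop 0)) (sg (stop 0))) (cong (λ z → 2ℤ * z) (sg-square (stop 0))))))

    module _ (r : ℕ) (reach : 2ℤ ℤ.≤ q (stop r) x (port (suc r))) where

      private
        H = q (stop r)
        y = port (suc (suc r))
        W : ℕ → Set
        W = Mem (suc r)
        T : ℕ → Set
        T v = v ≡ x ⊎ W v

      launch : Launch W H x (port (suc r))
      launch = record
        { isSkew = q-skew (stop r)
        ; x∉W = λ Wx → ℕₚ.<⇒≱ (x<lo r) (mem⇒lo≤ (suc r) Wx)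
        ; p∈W = inj₁ (port-block (suc r))
        ; x→p = reach
        ; x-rest = λ v Wv v≢p → flip-zero (stop r)
            (proj₂ (untouched r (stop r) ℕₚ.≤-refl) v x (mem⇒lo≤ (suc r) Wv) v≢p (x<lo r))
        ; rank = rank (suc r)
        ; rank-injective = rank-injective (suc r)
        ; ordered = λ {u} {v} Wu Wv lt →
            trans (proj₁ (untouched r (stop r) ℕₚ.≤-refl) u v (mem⇒lo≤ (suc r) Wu) (mem⇒lo≤ (suc r) Wv))
              (trans (G-adjacent {suc r} (Wu , Wv)) (oriented-< (suc r) lt))
        ; source = rank-source (suc r) }

      live-T : ∀ {v} → T v → Live v
      live-T (inj₁ refl) = 0 , port-block 0
      live-T (inj₂ Wv) = mem⇒live {suc r} Wv

      σ : ℕ → List ℕ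
      σ t = proj₁ (windowStack (lo (suc r)) (hi (suc r)) t)

      σ-start : σ (stop r) ≡ []
      σ-start = cong proj₁ (run-skip i stacks {Window (lo (suc r)) (hi (suc r))} empty 0 (stop r) z≤n
        λ m _ m<stop (le , _) → ℕₚ.<⇒≱ (early r m m<stop) le)

      dead : ∀ t → stop r ≤ t → t < stop (suc r) → ¬ Window (lo (suc r)) (hi (suc r)) t → ¬ Live (i t)
      dead t stop≤t t<stop ¬w (r′ , in-r′) with ℕₚ.<-cmp r′ (suc r)
      ... | tri< (s≤s r′≤r) _ _ = quiet r′ t (ℕₚ.≤-trans (stop-mono r′≤r) stop≤t) in-r′
      ... | tri≈ _ refl _ = ¬w in-r′
      ... | tri> _ _ r<r′ = ℕₚ.<⇒≱ (early (suc r) t t<stop) (ℕₚ.≤-trans (lo-mono r<r′) (proj₁ in-r′))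

      -- Mutation at a vertex of `T` changes the entries within `T` by a rule that involves only
      -- these. Every other mutation in this period is at a vertex of no block, which has no arrows
      -- to `T`.
      tracks : ∀ t → stop r ≤ t → t ≤ stop (suc r) → ∀ u v → T u → T v → q t u v ≡ μ* (σ t) H u v
      tracks t le le′ u v Tu Tv with ℕₚ.m≤n⇒m<n∨m≡n le
      ... | inj₂ refl = cong (λ st → μ* st H u v) (sym σ-start)
      tracks (suc t) _ t<stop u v Tu Tv | inj₁ (s≤s stop≤t)
        with tracks t stop≤t (ℕₚ.<⇒≤ t<stop) | em {Window (lo (suc r)) (hi (suc r)) t}
      ... | ih | yes w = trans (μ-cong-on T (inj₂ (inj₁ w)) ih u v Tu Tv) (μ*-push (i t) (σ t) H u v)
      ... | ih | no ¬w = trans (μ-no-path (i t) (q t) u v (apart Tu) (apart Tv)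
              (inj₁ (live-closed t (live-T Tu) ¬live))) (ih u v Tu Tv)
        where
        ¬live = dead t stop≤t t<stop ¬w
        apart : ∀ {v} → T v → i t ≢ v
        apart Tv refl = ¬live (live-T Tv)

      ready-suc : 2ℤ ℤ.≤ q (stop (suc r)) x y
      ready-suc rewrite tracks (stop (suc r)) (ℕₚ.<⇒≤ (stop<stop r)) ℕₚ.≤-refl x y (inj₁ refl) (inj₂ (inj₂ refl))
                | stack r =
        proj₂ (stack-fork launch y (inj₂ refl) y≢p (top r) (rest r)
          (subst (All (λ v → W v × v ≢ y)) (stack r) (All.map letter (windowStack-letters (lo (suc r)) (hi (suc r)) (stop (suc r)))))
          (subst (Linked _≢_) (stack r) (proj₂ (windowStack (lo (suc r)) (hi (suc r)) (stop (suc r)))))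
          (port-bottom r))
        where
        below-y : ∀ {v} → v < hi (suc r) → v ≢ y
        below-y lt refl = ℕₚ.<⇒≱ lt (ℕₚ.≤-trans (hi≤lo (ℕₚ.n<1+n (suc r))) (lo≤port (suc (suc r))))
        y≢p : y ≢ port (suc r)
        y≢p e = below-y (port<hi (suc r)) (sym e)
        letter : ∀ {v} → lo (suc r) ≤ v × v < hi (suc r) → W v × v ≢ y
        letter h = inj₁ h , below-y (proj₂ h)

    ready : ∀ r → 2ℤ ℤ.≤ q (stop r) x (port (suc r))
    ready zero = ready-0
    ready (suc r) = ready-suc r (ready r)

    -- A limit would have a finite row at `x`, yet once row `x` has settled it still shows, at time
    -- `stop (suc r)`, an arrow to a port beyond that support.
    Q′-diverges : 𝒟 i Q′
    Q′-diverges (L , conv) with conv (x ∷ []) | locFin⇒finiteRows {quiver L} (locFin L) x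
    ... | M , stable | B , zeros = absurd (stop (suc r)) refl (stop-expands (suc r))
      where
      r = M ℕ.⊔ B
      p = port (suc (suc r))
      far : B ≤ p
      far = ℕₚ.≤-trans (ℕₚ.m≤n⊔m M B) (ℕₚ.≤-trans (ℕₚ.≤-trans (ℕₚ.n≤1+n r) (ℕₚ.n≤1+n (suc r)))
              (ℕₚ.≤-trans (lo-expands (suc (suc r))) (lo≤port (suc (suc r)))))
      -- Convergence speaks of stages `suc m`; the lower bound on `T` exhibits `stop (suc r)` as a
      -- successor.
      absurd : ∀ T → stop (suc r) ≡ T → suc r ≤ T → ⊥
      absurd (suc m) e (s≤s r≤m) = ℤₚ.<-irrefl refl (subst (0ℤ ℤ.<_)
        (trans (overfill-row (stable m (ℕₚ.≤-trans (ℕₚ.m≤m⊔n M B) r≤m)) (here refl) p) (zeros p far))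
        (subst (λ T → 0ℤ ℤ.< q T x p) e (2≤⇒0< (ready (suc r)))))

  -- Density

  δ : ℕ → ℕ → ℤ
  δ a b with a ≟ b
  ... | yes _ = 1ℤ
  ... | no _ = 0ℤ

  δ-same : ∀ a → δ a a ≡ 1ℤ
  δ-same a with a ≟ a
  ... | yes _ = refl
  ... | no n = ⊥-elim (n refl)

  δ-other : ∀ {a b} → a ≢ b → δ a b ≡ 0ℤ
  δ-other {a} {b} n with a ≟ b
  ... | yes e = ⊥-elim (n e)
  ... | no _ = refl

  -- One arrow from `v` to `suc v`, written with `δ` so that skew-symmetry is a ring identity.
  arrowAt : ℕ → Quiver
  arrowAt v x y = δ x v * δ y (suc v) + - (δ x (suc v) * δ y v)

  arrowAt-skew : ∀ v → IsSkew (arrowAt v)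
  arrowAt-skew v x y = flip (δ x v) (δ y (suc v)) (δ x (suc v)) (δ y v)
    where
    flip : ∀ a b c d → a * b + - (c * d) ≡ - (d * c + - (b * a))
    flip = solve-∀

  arrowAt-finiteRows : ∀ v → FiniteRows (arrowAt v)
  arrowAt-finiteRows v x = suc (suc v) , λ y le → zero-row y (δ-other (ℕₚ.>⇒≢ le)) (δ-other (ℕₚ.>⇒≢ (ℕₚ.<⇒≤ le)))
    where
    zero-row : ∀ y → δ y (suc v) ≡ 0ℤ → δ y v ≡ 0ℤ → arrowAt v x y ≡ 0ℤ
    zero-row y e e′ rewrite e | e′ | ℤₚ.*-zeroʳ (δ x v) | ℤₚ.*-zeroʳ (δ x (suc v)) = refl

  arrowAt-below : ∀ {v x} → x < v → Isolated (arrowAt v) x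
  arrowAt-below {v} {x} x<v y rewrite δ-other (ℕₚ.<⇒≢ x<v) | δ-other (ℕₚ.<⇒≢ (ℕₚ.m<n⇒m<1+n x<v)) = refl

  arrowAt-value : ∀ v → arrowAt v v (suc v) ≡ 1ℤ
  arrowAt-value v rewrite δ-same v | δ-same (suc v) | δ-other (ℕₚ.<⇒≢ (ℕₚ.n<1+n v)) = refl

  singleArrow : ℕ → LFQuiver
  singleArrow v = mkLF (arrowAt v) (arrowAt-skew v) (finiteRows⇒locFin (arrowAt-finiteRows v))

  zeroQuiver : LFQuiver
  zeroQuiver = mkLF (λ _ _ → 0ℤ) (λ _ _ → refl) (finiteRows⇒locFin {λ _ _ → 0ℤ} λ _ → 0 , λ _ _ → refl)

  overfill-zero : ∀ V Q {x y} → Q x y ≡ 0ℤ → overfill V Q x y ≡ 0ℤ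
  overfill-zero V Q {x} {y} e with classical (x ∈ V) | classical (y ∈ V)
  ... | inj₁ x∈ | _ = trans (overfill-on V Q x y (inj₁ x∈)) e
  ... | inj₂ _ | inj₁ y∈ = trans (overfill-on V Q x y (inj₂ y∈)) e
  ... | inj₂ x∉ | inj₂ y∉ = overfill-off V Q x y x∉ y∉

  -- Every basic open set contains a quiver of finite support, and arrows among vertices from `M` on
  -- may be added without leaving the set. `B` serves to keep them away from `S∞`.
  record Truncation (Q : LFQuiver) (V : List ℕ) (B : ℕ) : Set where
    field
      M : ℕ
      B≤M : B ≤ M
      V<M : ∀ x → x ∈ V → x < M
      trunc : LFQuiver
      outer : ∀ v → M ≤ v → Isolated (quiver trunc) v
      rows : ∀ x → x ∈ V → ∀ y → quiver trunc x y ≡ quiver Q x y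

    agrees : ∀ (Q′ : LFQuiver) → (∀ x → x < M → ∀ y → quiver Q′ x y ≡ quiver trunc x y) →
      overfill V (quiver Q′) ≐ overfill V (quiver Q)
    agrees Q′ same = overfill-≐ V (skew Q′) (skew Q)
      λ x x∈ y → trans (same x (V<M x x∈) y) (rows x x∈ y)

  truncate : ∀ Q V B → Truncation Q V B
  truncate Q V B with eventually-all {λ x m → quiver Q x m ≡ 0ℤ} V (locFin⇒finiteRows {quiver Q} (locFin Q))
                    | eventually-all {λ x m → x < m} V (λ x → suc x , λ _ le → le)
  ... | M , zeros | M′ , above = record
    { M = M ℕ.⊔ M′ ℕ.⊔ B
    ; B≤M = ℕₚ.m≤n⊔m (M ℕ.⊔ M′) B
    ; V<M = above _ M′≤
    ; trunc = mkLF (overfill V (quiver Q)) (overfill-skew V (skew Q))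
        (finiteRows⇒locFin λ x → let N , z = locFin⇒finiteRows {quiver Q} (locFin Q) x in
          N , λ y le → overfill-zero V (quiver Q) (z y le))
    ; outer = λ v le w → outer v le w
    ; rows = λ x x∈ y → overfill-on V (quiver Q) x y (inj₁ x∈) }
    where
    M′≤ : M′ ≤ M ℕ.⊔ M′ ℕ.⊔ B
    M′≤ = ℕₚ.≤-trans (ℕₚ.m≤n⊔m M M′) (ℕₚ.m≤m⊔n (M ℕ.⊔ M′) B)
    M≤ : M ≤ M ℕ.⊔ M′ ℕ.⊔ B
    M≤ = ℕₚ.≤-trans (ℕₚ.m≤m⊔n M M′) (ℕₚ.m≤m⊔n (M ℕ.⊔ M′) B)
    outer : ∀ v → M ℕ.⊔ M′ ℕ.⊔ B ≤ v → ∀ w → overfill V (quiver Q) v w ≡ 0ℤ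
    outer v le w with classical (w ∈ V)
    ... | inj₁ w∈ = overfill-zero V (quiver Q) (skew-zero (skew Q) (zeros v (ℕₚ.≤-trans M≤ le) w w∈))
    ... | inj₂ w∉ = overfill-off V (quiver Q) v w
            (λ v∈ → ℕₚ.<-irrefl refl (above v (ℕₚ.≤-trans M′≤ le) v v∈)) w∉

  module _ (i : ℕ → ℕ) where

    sinfEmpty⇒dense𝒞 : SinfEmpty i → Dense (𝒞 i)
    sinfEmpty⇒dense𝒞 none Q V = trunc , finiteSupport⇒convergent i trunc none M outer ,
      agrees trunc (λ _ _ _ → refl)
      where open Truncation (truncate Q V 0)

    infOften⇒¬dense𝒞 : ∀ {v} → InfOften i v → ¬ Dense (𝒞 i)
    infOften⇒¬dense𝒞 {v} often dense with dense (singleArrow v) (v ∷ [])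
    ... | Q , conv , agree = 1≢0 (trans (sym (arrowAt-value v))
        (trans (sym (overfill-row agree (here refl) (suc v))) (convergent⇒isolated i Q often conv (suc v))))
      where
      1≢0 : 1ℤ ≢ 0ℤ
      1≢0 ()

    sinfInfinite⇒dense𝒟 : SinfInfinite i → Dense (𝒟 i)
    sinfInfinite⇒dense𝒟 unb Q V with ¬bounded⇒unbounded unb (Truncation.M (truncate Q V 0))
    ... | v , M≤v , often = Q″ , diverges , agrees Q″ inner
      where
      open Truncation (truncate Q V 0)
      Q″ : LFQuiver
      Q″ = trunc ⊕ singleArrow v
      inner : ∀ x → x < M → ∀ y → quiver Q″ x y ≡ quiver trunc x y
      inner x x<M y = trans (cong (λ z → quiver trunc x y + z) (arrowAt-below (ℕₚ.<-≤-trans x<M M≤v) y)) (ℤₚ.+-identityʳ _)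
      1≢0 : 1ℤ ≢ 0ℤ
      1≢0 ()
      diverges : 𝒟 i Q″
      diverges conv = 1≢0 (trans (sym (trans (cong₂ _+_ (outer v M≤v (suc v)) (arrowAt-value v)) refl))
        (convergent⇒isolated i Q″ often conv (suc v)))

    reductionInfinite⇒dense𝒟 : SinfFinite i → ReductionInfinite i (NotSinfPos i) → Dense (𝒟 i)
    reductionInfinite⇒dense𝒟 (B₀ , small) inf Q V =
      from (blockChain i B₀ (λ v le often → ℕₚ.<⇒≱ (small v often) le) inf M B≤M)
      where
      open Truncation (truncate Q V B₀)
      from : ∃[ C ] BlockChain.lo {i} C 0 ≡ M → ∃[ Q″ ] (𝒟 i Q″ × (overfill V (quiver Q″) ≐ overfill V (quiver Q)))
      from (C , lo≡M) = Q′ , Q′-diverges , agrees Q′ λ x x<M → Q′-inner x (subst (x <_) (sym lo≡M) x<M)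
        where open Divergence i C trunc (λ v le → outer v (subst (_≤ v) lo≡M le))

    -- Close to the zero quiver all of `S∞`, a subset of `upTo N`, is isolated, so only the letters
    -- outside `S∞` act.
    reductionFinite⇒¬dense𝒟 : SinfFinite i → ReductionFinite i (NotSinfPos i) → ¬ Dense (𝒟 i)
    reductionFinite⇒¬dense𝒟 (N , small) fin dense with dense zeroQuiver (upTo N)
    ... | Q , div , agree = div (reductionFinite⇒convergent i Q fin
            λ v often → overfill-row agree (∈-upTo⁺ (small v often)))

    sinfInfinite∨reductionInfinite⇒dense𝒟 : SinfInfinite i ⊎ ReductionInfinite i (NotSinfPos i) → Dense (𝒟 i)
    sinfInfinite∨reductionInfinite⇒dense𝒟 (inj₁ unb) = sinfInfinite⇒dense𝒟 unb
    sinfInfinite∨reductionInfinite⇒dense𝒟 (inj₂ inf) with classical (SinfFinite i)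
    ... | inj₁ fin = reductionInfinite⇒dense𝒟 fin inf
    ... | inj₂ unb = sinfInfinite⇒dense𝒟 unb

    dense𝒟⇒sinfInfinite∨reductionInfinite : Dense (𝒟 i) → SinfInfinite i ⊎ ReductionInfinite i (NotSinfPos i)
    dense𝒟⇒sinfInfinite∨reductionInfinite dense with classical (SinfFinite i)
    ... | inj₁ fin = inj₂ λ red → reductionFinite⇒¬dense𝒟 fin red dense
    ... | inj₂ unb = inj₁ unb

  -- Invariance of the reduction under equivalent position sets

  module _ (s : ℕ → ℕ) where

    _≋_ : (ℕ → Set) → (ℕ → Set) → Set
    K ≋ K′ = ∀ p → (K p → K′ p) × (K′ p → K p)

    ≋-sym : ∀ {K K′} → K ≋ K′ → K′ ≋ K
    ≋-sym h p = proj₂ (h p) , proj₁ (h p)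

    blockStart-≋ : ∀ {K K′} → K ≋ K′ → ∀ {p} → BlockStart s K p → BlockStart s K′ p
    blockStart-≋ h {p} (Kp , start) = proj₁ (h p) Kp ,
      λ r (Kr , r<p , gap) → start r (proj₂ (h r) Kr , r<p , λ t a b → gap t a b ∘ proj₁ (h t))

    inBlock-≋ : ∀ {K K′} → K ≋ K′ → ∀ {p} q → InBlock s K p q → InBlock s K′ p q
    inBlock-≋ h q (Kq , p≤q , const) = proj₁ (h q) Kq , p≤q , λ t a b → const t a b ∘ proj₂ (h t)

    reduce-≋ : ∀ {K K′} → K ≋ K′ → ∀ p → Reduce s K p → Reduce s K′ p
    reduce-≋ h p (bs , l , unique , odd , mem) = blockStart-≋ h bs , l , unique , odd , λ q →
      (λ b → proj₁ (mem q) (inBlock-≋ (≋-sym h) q b)) , λ q∈ → inBlock-≋ h q (proj₂ (mem q) q∈)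

    kseq-≋ : ∀ {K K′} → K ≋ K′ → ∀ m → Kseq s K m ≋ Kseq s K′ m
    kseq-≋ h zero = h
    kseq-≋ h (suc m) p = reduce-≋ (kseq-≋ h m) p , reduce-≋ (≋-sym (kseq-≋ h m)) p

    reductionFinite-≋ : ∀ {K K′} → K ≋ K′ → ReductionFinite s K → ReductionFinite s K′
    reductionFinite-≋ h (N , red) = N , λ p red′ → red p λ m → proj₂ (kseq-≋ h m p) (red′ m)

  module _ (i : ℕ → ℕ) where

    allPos≋notSinfPos : SinfEmpty i → _≋_ i AllPos (NotSinfPos i)
    allPos≋notSinfPos none p = (λ _ → none (i p)) , λ _ → _

theorem1p4 : ExcludedMiddle 0ℓ → (i : ℕ → ℕ) →
    ExactlyOne (∀ Q → 𝒞 i Q) (Dense (𝒞 i) × Dense (𝒟 i)) (¬ Dense (𝒞 i))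
    × ((∀ Q → 𝒞 i Q) ⇔ (SinfEmpty i × ReductionFinite i AllPos))
    × ((Dense (𝒞 i) × Dense (𝒟 i)) ⇔ (SinfEmpty i × ReductionInfinite i AllPos))
    × ((¬ Dense (𝒞 i)) ⇔ (¬ SinfEmpty i))
    × (¬ SinfEmpty i →
    (Dense (𝒟 i) ⇔ (SinfInfinite i ⊎ ReductionInfinite i (NotSinfPos i))))
theorem1p4 em i =
  (trichotomy , (λ (all , _ , 𝒟-dense) → all⇒¬dense𝒟 all 𝒟-dense)
              , (λ (all , ¬𝒞-dense) → ¬𝒞-dense (all⇒dense𝒞 all))
              , (λ ((𝒞-dense , _) , ¬𝒞-dense) → ¬𝒞-dense 𝒞-dense)) ,
  mk⇔ (λ all → dense𝒞⇒sinfEmpty (all⇒dense𝒞 all) ,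
               dne em (λ inf → all⇒¬dense𝒟 all (infinite⇒dense𝒟 (dense𝒞⇒sinfEmpty (all⇒dense𝒞 all)) inf)))
      (λ (none , fin) → finite⇒all none fin) ,
  mk⇔ (λ (𝒞-dense , 𝒟-dense) → dense𝒞⇒sinfEmpty 𝒞-dense ,
               λ fin → all⇒¬dense𝒟 (finite⇒all (dense𝒞⇒sinfEmpty 𝒞-dense) fin) 𝒟-dense)
      (λ (none , inf) → sinfEmpty⇒dense𝒞 em i none , infinite⇒dense𝒟 none inf) ,
  mk⇔ (λ ¬𝒞-dense none → ¬𝒞-dense (sinfEmpty⇒dense𝒞 em i none))
      (λ ¬none 𝒞-dense → ¬none (dense𝒞⇒sinfEmpty 𝒞-dense)) ,
  λ _ → mk⇔ (dense𝒟⇒sinfInfinite∨reductionInfinite em i) (sinfInfinite∨reductionInfinite⇒dense𝒟 em i)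
  where
  all⇒dense𝒞 : (∀ Q → 𝒞 i Q) → Dense (𝒞 i)
  all⇒dense𝒞 all Q V = Q , all Q , λ _ _ → refl
  all⇒¬dense𝒟 : (∀ Q → 𝒞 i Q) → ¬ Dense (𝒟 i)
  all⇒¬dense𝒟 all dense = let Q , div , _ = dense (zeroQuiver em) [] in div (all Q)
  dense𝒞⇒sinfEmpty : Dense (𝒞 i) → SinfEmpty i
  dense𝒞⇒sinfEmpty dense v often = infOften⇒¬dense𝒞 em i often dense
  finite⇒all : SinfEmpty i → ReductionFinite i AllPos → ∀ Q → 𝒞 i Q
  finite⇒all none fin Q = reductionFinite⇒convergent em i Q
    (reductionFinite-≋ em i (allPos≋notSinfPos em i none) fin) λ v often → ⊥-elim (none v often)
  infinite⇒dense𝒟 : SinfEmpty i → ReductionInfinite i AllPos → Dense (𝒟 i)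
  infinite⇒dense𝒟 none inf = reductionInfinite⇒dense𝒟 em i (0 , λ v often → ⊥-elim (none v often))
    (inf ∘ reductionFinite-≋ em i (≋-sym em i (allPos≋notSinfPos em i none)))
  trichotomy : (∀ Q → 𝒞 i Q) ⊎ (Dense (𝒞 i) × Dense (𝒟 i)) ⊎ ¬ Dense (𝒞 i)
  trichotomy with classical em (SinfEmpty i) | classical em (ReductionFinite i AllPos)
  ... | inj₂ ¬none | _ = inj₂ (inj₂ λ dense → ¬none (dense𝒞⇒sinfEmpty dense))
  ... | inj₁ none | inj₁ fin = inj₁ (finite⇒all none fin)
  ... | inj₁ none | inj₂ inf = inj₂ (inj₁ (sinfEmpty⇒dense𝒞 em i none , infinite⇒dense𝒟 none inf))
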